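{- Let $A \subset \mathbb{F}_2[x]$ be a primitive set of monic polynomials with $A \neq \{1\}$. Then $$\mathcal{F}(A) < 1 + \frac{e^{\gamma}}{2} = 1.890536\ldots.$$
   Context: $\mathbb{F}_2$ is the field with $2$ elements. A set $A \subset \mathbb{F}_2[x]$ of monic polynomials is primitive if no element of $A$ divides another (distinct) element of $A$. Here $\mathcal{F}(A) = \sum_{a \in A} \frac{1}{2^{\deg a} \deg a}$, and $\gamma = 0.577215\ldots$ is the Euler–Mascheroni constant. -}

module Defs where

open import Algebra.Bundles.Raw using (RawMagma)
import Algebra.Definitions.RawMagma as MagmaDefs
open import Data.Bool.Base using (Bool; true; false; _xor_; _∧_)
open import Data.Integer.Base as ℤ using (+_)
import Data.Integer.Properties as ℤₚ
open import Data.List.Base using (List; []; _∷_; _++_; map)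
open import Data.List.Relation.Unary.All using (All; []; _∷_)
open import Data.List.Relation.Unary.Unique.Propositional using (Unique)
open import Data.Nat.Base as ℕ using (ℕ; zero; suc; z≤n; s≤s)
import Data.Nat.Properties as ℕₚ
open import Data.Product using (∃-syntax; _×_; _,_; proj₁; proj₂)
open import Data.Rational.Base hiding (NonZero)
open import Data.Rational.Properties
import Data.Rational.Unnormalised.Base as ℚᵘ
import Data.Rational.Unnormalised.Properties as ℚᵘₚ
open import Data.Rational.Solver using (module +-*-Solver)
open import Data.Sum.Base using (inj₁; inj₂)
open import Data.Vec.Base using (Vec; []; toList)
open import Function.Base using (_∘_)
open import Level using (Level)
open import Relation.Binary.PropositionalEquality
open import Relation.Nullary using (¬_)
open import Relation.Unary using (Pred; _∈_)

open +-*-Solver using (solve; _:=_; _:+_; _:*_; :-_; _:-_; con)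

------------------------------------------------------------------------
-- Rational arithmetic

fromℕ : ℕ → ℚ
fromℕ n = + n / 1

recip : (n : ℕ) → .{{ℕ.NonZero n}} → ℚ
recip n = + 1 / n

∑ : ℕ → (ℕ → ℚ) → ℚ
∑ zero    f = 0ℚ
∑ (suc n) f = ∑ n f + f n

syntax ∑ n (λ i → e) = ∑[ i < n ] e

/-mono : ∀ a b c d .{{_ : ℕ.NonZero b}} .{{_ : ℕ.NonZero d}} →
         a ℕ.* d ℕ.≤ c ℕ.* b → + a / b ≤ + c / d
/-mono a (suc b) c (suc d) h = toℚᵘ-cancel-≤
  (ℚᵘₚ.≤-trans (ℚᵘₚ.≤-reflexive (toℚᵘ-fromℚᵘ (ℚᵘ.mkℚᵘ (+ a) b)))
    (ℚᵘₚ.≤-trans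
      (ℚᵘ.*≤* (subst₂ ℤ._≤_ (ℤₚ.pos-* a (suc d)) (ℤₚ.pos-* c (suc b)) (ℤ.+≤+ h)))
      (ℚᵘₚ.≤-reflexive (ℚᵘₚ.≃-sym (toℚᵘ-fromℚᵘ (ℚᵘ.mkℚᵘ (+ c) d))))))

/-≡ : ∀ a b c d .{{_ : ℕ.NonZero b}} .{{_ : ℕ.NonZero d}} →
      a ℕ.* d ≡ c ℕ.* b → + a / b ≡ + c / d
/-≡ a b c d e = ≤-antisym (/-mono a b c d (ℕₚ.≤-reflexive e))
                          (/-mono c d a b (ℕₚ.≤-reflexive (sym e)))

/-* : ∀ a b c d .{{_ : ℕ.NonZero b}} .{{_ : ℕ.NonZero d}} .{{_ : ℕ.NonZero (b ℕ.* d)}} →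
      (+ a / b) * (+ c / d) ≡ + (a ℕ.* c) / (b ℕ.* d)
/-* a (suc b) c (suc d) = toℚᵘ-injective
  (ℚᵘₚ.≃-trans (toℚᵘ-homo-* (+ a / suc b) (+ c / suc d))
    (ℚᵘₚ.≃-trans
      (ℚᵘₚ.*-cong (toℚᵘ-fromℚᵘ (ℚᵘ.mkℚᵘ (+ a) b)) (toℚᵘ-fromℚᵘ (ℚᵘ.mkℚᵘ (+ c) d)))
      (ℚᵘₚ.≃-trans
        (ℚᵘₚ.≃-reflexive (cong (λ z → ℚᵘ.mkℚᵘ z (d ℕ.+ b ℕ.* suc d)) (sym (ℤₚ.pos-* a c))))
        (ℚᵘₚ.≃-sym (toℚᵘ-fromℚᵘ (ℚᵘ.mkℚᵘ (+ (a ℕ.* c)) (d ℕ.+ b ℕ.* suc d)))))))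

fromℕ-suc : ∀ n → fromℕ (suc n) ≡ fromℕ n + 1ℚ
fromℕ-suc n = toℚᵘ-injective
  (ℚᵘₚ.≃-trans (toℚᵘ-fromℚᵘ (ℚᵘ.mkℚᵘ (+ suc n) 0))
  (ℚᵘₚ.≃-trans
    (ℚᵘ.*≡* (trans (ℤₚ.*-identityʳ (+ suc n))
      (sym (trans (ℤₚ.*-identityʳ _)
        (trans (cong₂ ℤ._+_ (ℤₚ.*-identityʳ (+ n)) refl)
          (cong +_ (ℕₚ.+-comm n 1)))))))
  (ℚᵘₚ.≃-trans (ℚᵘₚ.+-cong (ℚᵘₚ.≃-sym (toℚᵘ-fromℚᵘ (ℚᵘ.mkℚᵘ (+ n) 0)))
                           (ℚᵘₚ.≃-refl {ℚᵘ.1ℚᵘ}))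
    (ℚᵘₚ.≃-sym (toℚᵘ-homo-+ (fromℕ n) 1ℚ)))))

0≤/ : ∀ a b .{{_ : ℕ.NonZero b}} → 0ℚ ≤ + a / b
0≤/ a b = /-mono 0 1 a b z≤n

recip-mono : ∀ m n .{{_ : ℕ.NonZero m}} .{{_ : ℕ.NonZero n}} →
             m ℕ.≤ n → recip n ≤ recip m
recip-mono m n h = /-mono 1 n 1 m (ℕₚ.*-monoʳ-≤ 1 h)

archimedean : ∀ q → ∃[ n ] q ≤ fromℕ n
archimedean q@(mkℚ (+ a) d _) = a , subst (_≤ fromℕ a) (↥p/↧p≡p q)
  (/-mono a (suc d) a 1 (ℕₚ.*-monoʳ-≤ a {1} {suc d} (s≤s z≤n)))
archimedean q@(mkℚ ℤ.-[1+ a ] d _) = 0 , <⇒≤ (negative⁻¹ q)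

small-recip : ∀ {ε} → 0ℚ < ε → ∃[ k ] recip (suc k) ≤ ε
small-recip {q@(mkℚ (+ zero) d _)} h with positive {q} h
... | ()
small-recip {q@(mkℚ (+ suc a) d _)} h = d , subst (recip (suc d) ≤_) (↥p/↧p≡p q)
  (/-mono 1 (suc d) (suc a) (suc d) (ℕₚ.*-monoˡ-≤ (suc d) (s≤s (z≤n {a}))))
small-recip {q@(mkℚ ℤ.-[1+ a ] d _)} h with positive {q} h
... | ()

0<recip : ∀ k → 0ℚ < recip (suc k)
0<recip k = positive⁻¹ (recip (suc k)) {{normalize-pos 1 (suc k)}}

*-pos : ∀ {p q} → 0ℚ < p → 0ℚ < q → 0ℚ < p * q
*-pos {p} {q} hp hq =
  positive⁻¹ (p * q) {{pos*pos⇒pos p {{positive hp}} q {{positive hq}}}}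

*-monoˡ : ∀ {p q r} → 0ℚ ≤ r → p ≤ q → r * p ≤ r * q
*-monoˡ {r = r} h = *-monoˡ-≤-nonNeg r {{nonNegative h}}

*-monoʳ : ∀ {p q r} → 0ℚ ≤ r → p ≤ q → p * r ≤ q * r
*-monoʳ {r = r} h = *-monoʳ-≤-nonNeg r {{nonNegative h}}

*-mono : ∀ {p q r s} → 0ℚ ≤ r → 0ℚ ≤ q → p ≤ q → r ≤ s → p * r ≤ q * s
*-mono hr hq h k = ≤-trans (*-monoʳ hr h) (*-monoˡ hq k)

*-nonneg : ∀ {p q} → 0ℚ ≤ p → 0ℚ ≤ q → 0ℚ ≤ p * q
*-nonneg {p} {q} hp hq = subst (_≤ p * q) (*-zeroʳ p) (*-monoˡ hp hq)

small-multiple : ∀ q {ε} → 0ℚ < ε → ∃[ k ] q * recip (suc k) ≤ ε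
small-multiple q {ε} h with archimedean q | small-recip h
... | c , q≤c | k , rk≤ε = k ℕ.+ c ℕ.* suc k , ≤-trans step rk≤ε
  where
  open ≤-Reasoning
  step : q * recip (suc c ℕ.* suc k) ≤ recip (suc k)
  step = begin
    q * recip (suc c ℕ.* suc k)
      ≤⟨ *-monoʳ (0≤/ 1 (suc c ℕ.* suc k)) (≤-trans q≤c
           (/-mono c 1 (suc c) 1 (ℕₚ.*-monoˡ-≤ 1 (ℕₚ.n≤1+n c)))) ⟩
    fromℕ (suc c) * recip (suc c ℕ.* suc k)
      ≡⟨ /-* (suc c) 1 1 (suc c ℕ.* suc k) ⟩
    + (suc c ℕ.* 1) / (1 ℕ.* (suc c ℕ.* suc k))
      ≡⟨ /-≡ (suc c ℕ.* 1) (1 ℕ.* (suc c ℕ.* suc k)) 1 (suc k)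
           (trans (cong (ℕ._* suc k) (ℕₚ.*-identityʳ (suc c)))
             (sym (trans (ℕₚ.*-identityˡ _) (ℕₚ.*-identityˡ _)))) ⟩
    recip (suc k) ∎

half-pos : ∀ {ε} → 0ℚ < ε → 0ℚ < ½ * ε
half-pos = *-pos (0<recip 1)

½+½ : ∀ ε → ½ * ε + ½ * ε ≡ ε
½+½ ε = trans (sym (*-distribʳ-+ ε ½ ½)) (*-identityˡ ε)

∣-∣-comm : ∀ p q → ∣ p - q ∣ ≡ ∣ q - p ∣
∣-∣-comm p q = trans
  (cong ∣_∣ (solve 2 (λ p q → p :- q := :- (q :- p)) refl p q)) (∣-p∣≡∣p∣ (q - p))

∣-∣-triangle : ∀ p q r → ∣ p - r ∣ ≤ ∣ p - q ∣ + ∣ q - r ∣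
∣-∣-triangle p q r = subst (λ z → ∣ z ∣ ≤ ∣ p - q ∣ + ∣ q - r ∣)
  (solve 3 (λ p q r → (p :- q) :+ (q :- r) := p :- r) refl p q r)
  (∣p+q∣≤∣p∣+∣q∣ (p - q) (q - r))

∣-∣-between : ∀ {p q r} → p ≤ q → q ≤ p + r → ∣ p - q ∣ ≤ r
∣-∣-between {p} {q} {r} h k = begin
  ∣ p - q ∣   ≡⟨ ∣-∣-comm p q ⟩
  ∣ q - p ∣   ≡⟨ 0≤p⇒∣p∣≡p (subst (_≤ q - p) (+-inverseʳ p) (+-monoˡ-≤ (- p) h)) ⟩
  q - p       ≤⟨ +-monoˡ-≤ (- p) k ⟩
  p + r - p   ≡⟨ solve 2 (λ p r → p :+ r :- p := r) refl p r ⟩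
  r           ∎
  where open ≤-Reasoning

∑-split : ∀ f a b → ∑[ i < a ℕ.+ b ] f i ≡ ∑[ i < a ] f i + ∑[ i < b ] f (a ℕ.+ i)
∑-split f a zero    = trans (cong (λ z → ∑ z f) (ℕₚ.+-identityʳ a)) (sym (+-identityʳ _))
∑-split f a (suc b) = trans (cong (λ z → ∑ z f) (ℕₚ.+-suc a b))
  (trans (cong (_+ f (a ℕ.+ b)) (∑-split f a b)) (+-assoc (∑ a f) _ _))

∑-cong : ∀ n {f g : ℕ → ℚ} → (∀ i → f i ≡ g i) → ∑ n f ≡ ∑ n g
∑-cong zero    h = refl
∑-cong (suc n) h = cong₂ _+_ (∑-cong n h) (h n)

∑-mono : ∀ n {f g : ℕ → ℚ} → (∀ i → i ℕ.< n → f i ≤ g i) → ∑ n f ≤ ∑ n g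
∑-mono zero    h = ≤-refl
∑-mono (suc n) h = +-mono-≤ (∑-mono n (λ i i<n → h i (ℕₚ.m<n⇒m<1+n i<n))) (h n ℕₚ.≤-refl)

∑-const : ∀ n c → ∑[ i < n ] c ≡ fromℕ n * c
∑-const zero    c = sym (*-zeroˡ c)
∑-const (suc n) c = trans (cong₂ _+_ (∑-const n c) (sym (*-identityˡ c)))
  (trans (sym (*-distribʳ-+ c (fromℕ n) 1ℚ)) (cong (_* c) (sym (fromℕ-suc n))))

∣∑∣≤∑ : ∀ n {f g : ℕ → ℚ} → (∀ i → ∣ f i ∣ ≤ g i) → ∣ ∑ n f ∣ ≤ ∑ n g
∣∑∣≤∑ zero    h = ≤-refl
∣∑∣≤∑ (suc n) {f} h =
  ≤-trans (∣p+q∣≤∣p∣+∣q∣ (∑ n f) (f n)) (+-mono-≤ (∣∑∣≤∑ n h) (h n))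

------------------------------------------------------------------------
-- Real numbers as Cauchy sequences of rationals

Cauchy : (ℕ → ℚ) → Set
Cauchy s = ∀ {ε} → 0ℚ < ε →
  ∃[ N ] (∀ {m n} → N ℕ.≤ m → N ℕ.≤ n → ∣ s m - s n ∣ ≤ ε)

record ℝ : Set where
  constructor mkℝ
  field
    approx : ℕ → ℚ
    cauchy : Cauchy approx
open ℝ public

infix  4 _<ᴿ_ _≈[_]_
infixl 6 _+ᴿ_ _-ᴿ_
infixl 7 _*ᴿ_

_<ᴿ_ : ℝ → ℝ → Set
x <ᴿ y = ∃[ ε ] 0ℚ < ε × ∃[ N ] (∀ {n} → N ℕ.≤ n → approx x n + ε ≤ approx y n)

-- Eventual closeness; up to an arbitrarily small error this says ∣x − y∣ ≤ ε.
_≈[_]_ : ℝ → ℚ → ℝ → Set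
x ≈[ ε ] y = ∃[ N ] (∀ {n} → N ℕ.≤ n → ∣ approx x n - approx y n ∣ ≤ ε)

fromℚ : ℚ → ℝ
fromℚ q = mkℝ (λ _ → q) λ {ε} 0<ε →
  0 , λ _ _ → subst (λ z → ∣ z ∣ ≤ ε) (sym (+-inverseʳ q)) (<⇒≤ 0<ε)

_+ᴿ_ : ℝ → ℝ → ℝ
x +ᴿ y = mkℝ (λ n → approx x n + approx y n) λ {ε} 0<ε →
  let M , p = cauchy x (half-pos 0<ε)
      N , q = cauchy y (half-pos 0<ε)
  in M ℕ.⊔ N , λ {m} {n} hm hn →
     let a = approx x m; b = approx y m; c = approx x n; d = approx y n in
     subst₂ _≤_
       (cong ∣_∣ (solve 4 (λ a b c d → (a :- c) :+ (b :- d) := (a :+ b) :- (c :+ d))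
                          refl a b c d))
       (½+½ ε)
       (≤-trans (∣p+q∣≤∣p∣+∣q∣ (a - c) (b - d))
         (+-mono-≤ (p (ℕₚ.m⊔n≤o⇒m≤o M N hm) (ℕₚ.m⊔n≤o⇒m≤o M N hn))
                   (q (ℕₚ.m⊔n≤o⇒n≤o M N hm) (ℕₚ.m⊔n≤o⇒n≤o M N hn))))

-ᴿ_ : ℝ → ℝ
-ᴿ x = mkℝ (λ n → - approx x n) λ {ε} 0<ε →
  let N , p = cauchy x 0<ε
  in N , λ {m} {n} hm hn →
     subst (_≤ ε)
       (trans (∣-∣-comm (approx x m) (approx x n))
         (cong ∣_∣ (solve 2 (λ a b → b :- a := (:- a) :- (:- b)) refl
                            (approx x m) (approx x n))))
       (p hm hn)

_-ᴿ_ : ℝ → ℝ → ℝ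
x -ᴿ y = x +ᴿ (-ᴿ y)

bounded : ∀ x → ∃[ b ] ∃[ N ] (∀ {n} → N ℕ.≤ n → ∣ approx x n ∣ ≤ fromℕ b)
bounded x =
  let N , p = cauchy x (0<recip 0)
      b , q = archimedean (1ℚ + ∣ approx x N ∣)
  in b , N , λ {n} hn →
     let a = approx x n; c = approx x N in
     ≤-trans (subst (λ z → ∣ z ∣ ≤ ∣ a - c ∣ + ∣ c ∣)
                    (solve 2 (λ a c → (a :- c) :+ c := a) refl a c)
                    (∣p+q∣≤∣p∣+∣q∣ (a - c) c))
       (≤-trans (+-monoˡ-≤ ∣ c ∣ (p hn ℕₚ.≤-refl)) q)

_*ᴿ_ : ℝ → ℝ → ℝ
x *ᴿ y = mkℝ (λ n → approx x n * approx y n) λ {ε} 0<ε →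
  let b , B , bx = bounded x
      c , C , cy = bounded y
      k , bk≤ = small-multiple (fromℕ b) (half-pos 0<ε)
      l , cl≤ = small-multiple (fromℕ c) (half-pos 0<ε)
      M , p = cauchy x (0<recip l)
      N , q = cauchy y (0<recip k)
  in (B ℕ.⊔ C) ℕ.⊔ (M ℕ.⊔ N) , λ {m} {n} hm hn →
     let u = approx x m; v = approx y m; u′ = approx x n; v′ = approx y n
         hmB = ℕₚ.m⊔n≤o⇒m≤o B C (ℕₚ.m⊔n≤o⇒m≤o (B ℕ.⊔ C) (M ℕ.⊔ N) hm)
         hnC = ℕₚ.m⊔n≤o⇒n≤o B C (ℕₚ.m⊔n≤o⇒m≤o (B ℕ.⊔ C) (M ℕ.⊔ N) hn)
         hm′ = ℕₚ.m⊔n≤o⇒n≤o (B ℕ.⊔ C) (M ℕ.⊔ N) hm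
         hn′ = ℕₚ.m⊔n≤o⇒n≤o (B ℕ.⊔ C) (M ℕ.⊔ N) hn
         du = p (ℕₚ.m⊔n≤o⇒m≤o M N hm′) (ℕₚ.m⊔n≤o⇒m≤o M N hn′)
         dv = q (ℕₚ.m⊔n≤o⇒n≤o M N hm′) (ℕₚ.m⊔n≤o⇒n≤o M N hn′)
     in subst₂ _≤_
          (cong ∣_∣ (solve 4 (λ u v u′ v′ → u :* (v :- v′) :+ v′ :* (u :- u′)
                                            := u :* v :- u′ :* v′)
                             refl u v u′ v′))
          (½+½ ε)
          (≤-trans (∣p+q∣≤∣p∣+∣q∣ (u * (v - v′)) (v′ * (u - u′)))
            (+-mono-≤
              (subst (_≤ ½ * ε) (sym (∣p*q∣≡∣p∣*∣q∣ u (v - v′)))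
                (≤-trans (*-mono (0≤∣p∣ (v - v′)) (0≤/ b 1) (bx hmB) dv) bk≤))
              (subst (_≤ ½ * ε) (sym (∣p*q∣≡∣p∣*∣q∣ v′ (u - u′)))
                (≤-trans (*-mono (0≤∣p∣ (u - u′)) (0≤/ c 1) (cy hnC) du) cl≤))))

∑ᴿ : ℕ → (ℕ → ℝ) → ℝ
∑ᴿ zero    f = fromℚ 0ℚ
∑ᴿ (suc n) f = ∑ᴿ n f +ᴿ f n

syntax ∑ᴿ n (λ i → e) = ∑ᴿ[ i < n ] e

Cauchyᴿ : (ℕ → ℝ) → Set
Cauchyᴿ X = ∀ {ε} → 0ℚ < ε →
  ∃[ K ] (∀ {k l} → K ℕ.≤ k → K ℕ.≤ l → X k ≈[ ε ] X l)

-- The limit of a Cauchy sequence of reals: its k-th approximation is a rational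
-- approximation of X k that is accurate to within 1/(k+1).
lim : (X : ℕ → ℝ) → Cauchyᴿ X → ℝ
lim X cX = mkℝ (λ k → approx (X k) (index k)) λ {ε} 0<ε →
  let 0<δ = half-pos 0<ε
      r , r≤ = small-recip (half-pos 0<δ)
      K , p = cX 0<δ
  in r ℕ.⊔ K , λ {k} {l} hk hl →
     let N , q = p (ℕₚ.m⊔n≤o⇒n≤o r K hk) (ℕₚ.m⊔n≤o⇒n≤o r K hl)
         n = N ℕ.⊔ (index k ℕ.⊔ index l)
         N≤n = ℕₚ.m≤m⊔n N (index k ℕ.⊔ index l)
         I≤n = ℕₚ.m≤n⊔m N (index k ℕ.⊔ index l)
         a = approx (X k) (index k); b = approx (X l) (index l)
         c = approx (X k) n; d = approx (X l) n
         near₁ = near r≤ (ℕₚ.m⊔n≤o⇒m≤o r K hk) (ℕₚ.m⊔n≤o⇒m≤o (index k) (index l) I≤n)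
         near₂ = near r≤ (ℕₚ.m⊔n≤o⇒m≤o r K hl) (ℕₚ.m⊔n≤o⇒n≤o (index k) (index l) I≤n)
     in ≤-trans (∣-∣-triangle a c b)
          (≤-trans (+-monoʳ-≤ ∣ a - c ∣ (∣-∣-triangle c d b))
            (≤-trans (+-mono-≤ near₁ (+-mono-≤ (q N≤n) (subst (_≤ ½ * (½ * ε)) (∣-∣-comm b d) near₂)))
              (≤-reflexive (trans (regroup (½ * (½ * ε)) (½ * ε))
                (trans (cong (_+ ½ * ε) (½+½ (½ * ε))) (½+½ ε))))))
  where
  index : ℕ → ℕ
  index k = proj₁ (cauchy (X k) (0<recip k))

  near : ∀ {r δ} → recip (suc r) ≤ δ → ∀ {k n} → r ℕ.≤ k → index k ℕ.≤ n →
         ∣ approx (X k) (index k) - approx (X k) n ∣ ≤ δ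
  near {r} r≤ {k} hk hn = ≤-trans (proj₂ (cauchy (X k) (0<recip k)) ℕₚ.≤-refl hn)
    (≤-trans (recip-mono (suc r) (suc k) (s≤s hk)) r≤)

  regroup : ∀ a b → a + (b + a) ≡ (a + a) + b
  regroup = solve 2 (λ a b → a :+ (b :+ a) := (a :+ a) :+ b) refl

Cauchyᴿ-≤ : ∀ X → (∀ {ε} → 0ℚ < ε → ∃[ K ] (∀ {k} d → K ℕ.≤ k → X k ≈[ ε ] X (k ℕ.+ d))) →
            Cauchyᴿ X
Cauchyᴿ-≤ X h {ε} 0<ε with h 0<ε
... | K , p = K , go
  where
  flip : ∀ {x y} → x ≈[ ε ] y → y ≈[ ε ] x
  flip {x} {y} (N , q) =
    N , λ {n} hn → subst (_≤ ε) (∣-∣-comm (approx x n) (approx y n)) (q hn)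

  go : ∀ {k l} → K ℕ.≤ k → K ℕ.≤ l → X k ≈[ ε ] X l
  go {k} {l} hk hl with ℕₚ.≤-total k l
  ... | inj₁ k≤l = subst (λ z → X k ≈[ ε ] X z) (ℕₚ.m+[n∸m]≡n k≤l) (p (l ℕ.∸ k) hk)
  ... | inj₂ l≤k = flip {X l} {X k}
                     (subst (λ z → X l ≈[ ε ] X z) (ℕₚ.m+[n∸m]≡n l≤k) (p (k ℕ.∸ l) hl))

------------------------------------------------------------------------
-- The exponential function

-- xʲ / j!
powerOverFactorial : ℝ → ℕ → ℝ
powerOverFactorial x zero    = fromℚ 1ℚ
powerOverFactorial x (suc j) = powerOverFactorial x j *ᴿ x *ᴿ fromℚ (recip (suc j))

expPartial : ℝ → ℕ → ℝ
expPartial x k = ∑ᴿ[ j < k ] powerOverFactorial x j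

-- qʲ / j!
pf : ℚ → ℕ → ℚ
pf q zero    = 1ℚ
pf q (suc j) = pf q j * q * recip (suc j)

pf-approx : ∀ x j n → approx (powerOverFactorial x j) n ≡ pf (approx x n) j
pf-approx x zero    n = refl
pf-approx x (suc j) n = cong (λ z → z * approx x n * recip (suc j)) (pf-approx x j n)

expPartial-approx : ∀ x k n → approx (expPartial x k) n ≡ ∑[ j < k ] pf (approx x n) j
expPartial-approx x zero    n = refl
expPartial-approx x (suc k) n = cong₂ _+_ (expPartial-approx x k n) (pf-approx x k n)

pf-nonneg : ∀ b j → 0ℚ ≤ pf (fromℕ b) j
pf-nonneg b zero    = <⇒≤ (0<recip 0)
pf-nonneg b (suc j) = *-nonneg (*-nonneg (pf-nonneg b j) (0≤/ b 1)) (0≤/ 1 (suc j))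

∣pf∣≤ : ∀ {q} b → ∣ q ∣ ≤ fromℕ b → ∀ j → ∣ pf q j ∣ ≤ pf (fromℕ b) j
∣pf∣≤ {q} b h zero    = ≤-refl
∣pf∣≤ {q} b h (suc j) = begin
  ∣ pf q j * q * r ∣          ≡⟨ ∣p*q∣≡∣p∣*∣q∣ (pf q j * q) r ⟩
  ∣ pf q j * q ∣ * ∣ r ∣      ≡⟨ cong₂ _*_ (∣p*q∣≡∣p∣*∣q∣ (pf q j) q) (0≤p⇒∣p∣≡p 0≤r) ⟩
  ∣ pf q j ∣ * ∣ q ∣ * r      ≤⟨ *-monoʳ 0≤r (*-mono (0≤∣p∣ q) (pf-nonneg b j) (∣pf∣≤ b h j) h) ⟩
  pf (fromℕ b) j * fromℕ b * r ∎
  where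
  open ≤-Reasoning
  r = recip (suc j)
  0≤r = 0≤/ 1 (suc j)

module _ (b : ℕ) where
  private
    t : ℕ → ℚ
    t = pf (fromℕ b)

  pf-halves : ∀ j → b ℕ.+ b ℕ.≤ j → t (suc j) ≤ ½ * t j
  pf-halves j h = begin
    t j * fromℕ b * recip (suc j)    ≡⟨ *-assoc (t j) _ _ ⟩
    t j * (fromℕ b * recip (suc j))  ≤⟨ *-monoˡ (pf-nonneg b j) step ⟩
    t j * ½                          ≡⟨ *-comm (t j) ½ ⟩
    ½ * t j                          ∎
    where
    open ≤-Reasoning
    step : fromℕ b * recip (suc j) ≤ ½
    step = subst (_≤ ½) (sym (/-* b 1 1 (suc j)))
      (/-mono (b ℕ.* 1) (1 ℕ.* suc j) 1 2
        (subst₂ ℕ._≤_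
          (trans (cong (b ℕ.+_) (sym (ℕₚ.+-identityʳ b)))
            (trans (ℕₚ.*-comm 2 b) (cong (ℕ._* 2) (sym (ℕₚ.*-identityʳ b)))))
          (sym (trans (ℕₚ.*-identityˡ _) (ℕₚ.*-identityˡ (suc j))))
          (ℕₚ.m≤n⇒m≤1+n h)))

  pf-tail : ∀ s → b ℕ.+ b ℕ.≤ s → ∀ l →
            ∑[ i < l ] t (s ℕ.+ i) + (t (s ℕ.+ l) + t (s ℕ.+ l)) ≤ t s + t s
  pf-tail s h zero    = ≤-reflexive (trans (+-identityˡ _)
    (cong (λ z → t z + t z) (ℕₚ.+-identityʳ s)))
  pf-tail s h (suc l) = begin
    S + t (s ℕ.+ l) + (t (s ℕ.+ suc l) + t (s ℕ.+ suc l))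
      ≡⟨ cong (λ z → S + t (s ℕ.+ l) + (t z + t z)) (ℕₚ.+-suc s l) ⟩
    S + t (s ℕ.+ l) + (t (suc (s ℕ.+ l)) + t (suc (s ℕ.+ l)))
      ≤⟨ +-monoʳ-≤ (S + t (s ℕ.+ l)) (+-mono-≤ half half) ⟩
    S + t (s ℕ.+ l) + (½ * t (s ℕ.+ l) + ½ * t (s ℕ.+ l))
      ≡⟨ cong (λ z → S + t (s ℕ.+ l) + z) (½+½ (t (s ℕ.+ l))) ⟩
    S + t (s ℕ.+ l) + t (s ℕ.+ l)
      ≡⟨ +-assoc S _ _ ⟩
    S + (t (s ℕ.+ l) + t (s ℕ.+ l))
      ≤⟨ pf-tail s h l ⟩
    t s + t s ∎
    where
    open ≤-Reasoning
    S = ∑[ i < l ] t (s ℕ.+ i)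
    half = pf-halves (s ℕ.+ l) (ℕₚ.≤-trans h (ℕₚ.m≤m+n s l))

  pf-decay : ∀ k → t (b ℕ.+ b ℕ.+ k) ≤ t (b ℕ.+ b) * recip (suc k)
  pf-decay zero    = ≤-reflexive (trans (cong t (ℕₚ.+-identityʳ (b ℕ.+ b)))
    (sym (*-identityʳ _)))
  pf-decay (suc k) = begin
    t (b ℕ.+ b ℕ.+ suc k)
      ≡⟨ cong t (ℕₚ.+-suc (b ℕ.+ b) k) ⟩
    t (suc (b ℕ.+ b ℕ.+ k))
      ≤⟨ pf-halves (b ℕ.+ b ℕ.+ k) (ℕₚ.m≤m+n (b ℕ.+ b) k) ⟩
    ½ * t (b ℕ.+ b ℕ.+ k)
      ≤⟨ *-monoˡ (0≤/ 1 2) (pf-decay k) ⟩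
    ½ * (t (b ℕ.+ b) * recip (suc k))
      ≡⟨ solve 3 (λ h a r → h :* (a :* r) := a :* (h :* r)) refl ½ (t (b ℕ.+ b)) (recip (suc k)) ⟩
    t (b ℕ.+ b) * (½ * recip (suc k))
      ≤⟨ *-monoˡ (pf-nonneg b (b ℕ.+ b)) step ⟩
    t (b ℕ.+ b) * recip (suc (suc k)) ∎
    where
    open ≤-Reasoning
    step : ½ * recip (suc k) ≤ recip (suc (suc k))
    step = subst (_≤ recip (suc (suc k))) (sym (/-* 1 2 1 (suc k)))
      (/-mono 1 (2 ℕ.* suc k) 1 (suc (suc k))
        (ℕₚ.*-monoʳ-≤ 1 (s≤s (subst (suc k ℕ.≤_) (sym (ℕₚ.+-suc k (k ℕ.+ 0)))
          (s≤s (ℕₚ.m≤m+n k _))))))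

expPartial-cauchy : ∀ x → Cauchyᴿ (expPartial x)
expPartial-cauchy x = Cauchyᴿ-≤ (expPartial x) λ {ε} 0<ε →
  let b , N , bx = bounded x
      J = b ℕ.+ b
      r , r≤ = small-multiple (pf (fromℕ b) J) (half-pos 0<ε)
  in J ℕ.+ r , λ {k} d hk → N , λ {n} hn →
     let q = approx x n
         r≤k∸J = subst (ℕ._≤ k ℕ.∸ J) (ℕₚ.m+n∸m≡n J r) (ℕₚ.∸-monoˡ-≤ J hk)
         J≤k = ℕₚ.≤-trans (ℕₚ.m≤m+n J r) hk
         tk≤ = ≤-trans (subst (λ z → pf (fromℕ b) z ≤ pf (fromℕ b) J * recip (suc (k ℕ.∸ J)))
                              (ℕₚ.m+[n∸m]≡n J≤k) (pf-decay b (k ℕ.∸ J)))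
                 (≤-trans (*-monoˡ (pf-nonneg b J)
                            (recip-mono (suc r) (suc (k ℕ.∸ J)) (s≤s r≤k∸J))) r≤)
         S = ∑[ i < k ] pf q i
         T = ∑[ i < d ] pf q (k ℕ.+ i)
         t+t≥0 = +-mono-≤ (pf-nonneg b (k ℕ.+ d)) (pf-nonneg b (k ℕ.+ d))
     in begin
       ∣ approx (expPartial x k) n - approx (expPartial x (k ℕ.+ d)) n ∣
         ≡⟨ cong₂ (λ u v → ∣ u - v ∣) (expPartial-approx x k n)
              (trans (expPartial-approx x (k ℕ.+ d) n) (∑-split (pf q) k d)) ⟩
       ∣ S - (S + T) ∣
         ≡⟨ cong ∣_∣ (solve 2 (λ s t → s :- (s :+ t) := :- t) refl S T) ⟩
       ∣ - T ∣
         ≡⟨ ∣-p∣≡∣p∣ T ⟩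
       ∣ T ∣
         ≤⟨ ∣∑∣≤∑ d (λ i → ∣pf∣≤ b (bx hn) (k ℕ.+ i)) ⟩
       ∑[ i < d ] pf (fromℕ b) (k ℕ.+ i)
         ≡⟨ sym (+-identityʳ _) ⟩
       ∑[ i < d ] pf (fromℕ b) (k ℕ.+ i) + 0ℚ
         ≤⟨ +-monoʳ-≤ (∑[ i < d ] pf (fromℕ b) (k ℕ.+ i)) t+t≥0 ⟩
       ∑[ i < d ] pf (fromℕ b) (k ℕ.+ i) + (pf (fromℕ b) (k ℕ.+ d) + pf (fromℕ b) (k ℕ.+ d))
         ≤⟨ pf-tail b k J≤k d ⟩
       pf (fromℕ b) k + pf (fromℕ b) k
         ≤⟨ +-mono-≤ tk≤ tk≤ ⟩
       ½ * ε + ½ * ε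
         ≡⟨ ½+½ ε ⟩
       ε ∎
  where open ≤-Reasoning

exp : ℝ → ℝ
exp x = lim (expPartial x) (expPartial-cauchy x)

------------------------------------------------------------------------
-- Logarithms of positive integers and the Euler–Mascheroni constant

-- 1/(s+1) + 1/(s+2) + ⋯ + 1/(s+l)
segment : ℕ → ℕ → ℚ
segment s l = ∑[ i < l ] recip (suc (s ℕ.+ i))

harmonic : ℕ → ℚ
harmonic n = segment 0 n

segment-split : ∀ s a b → segment s (a ℕ.+ b) ≡ segment s a + segment (s ℕ.+ a) b
segment-split s a b = trans (∑-split (λ i → recip (suc (s ℕ.+ i))) a b)
  (cong (λ z → segment s a + z) (∑-cong b (λ i → cong (λ z → recip (suc z)) (sym (ℕₚ.+-assoc s a i)))))

module _ (M : ℕ) .{{_ : ℕ.NonZero M}} where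

  recip-scale : ∀ t .{{_ : ℕ.NonZero t}} .{{_ : ℕ.NonZero (t ℕ.* M)}} →
                fromℕ M * recip (t ℕ.* M) ≡ recip t
  recip-scale t = trans (/-* M 1 1 (t ℕ.* M) {{ℕ.nonZero}} {{ℕₚ.m*n≢0 t M}} {{nz}})
    (/-≡ (M ℕ.* 1) (1 ℕ.* (t ℕ.* M)) 1 t {{nz}}
      (trans (cong (ℕ._* t) (ℕₚ.*-identityʳ M))
        (trans (ℕₚ.*-comm M t) (sym (trans (ℕₚ.*-identityˡ _) (ℕₚ.*-identityˡ _))))))
    where
    nz : ℕ.NonZero (1 ℕ.* (t ℕ.* M))
    nz = ℕₚ.m*n≢0 1 (t ℕ.* M)

  block-lower : ∀ t → recip (suc t) ≤ segment (t ℕ.* M) M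
  block-lower t = begin
    recip (suc t)                     ≡⟨ sym (recip-scale (suc t) {{_}} {{nz}}) ⟩
    fromℕ M * r                       ≡⟨ sym (∑-const M r) ⟩
    ∑[ i < M ] r
      ≤⟨ ∑-mono M (λ i i<M → recip-mono (suc (t ℕ.* M ℕ.+ i)) (suc t ℕ.* M) {{_}} {{nz}}
           (subst₂ ℕ._≤_ (ℕₚ.+-suc (t ℕ.* M) i) (ℕₚ.+-comm (t ℕ.* M) M)
             (ℕₚ.+-monoʳ-≤ (t ℕ.* M) i<M))) ⟩
    segment (t ℕ.* M) M               ∎
    where
    open ≤-Reasoning
    nz : ℕ.NonZero (suc t ℕ.* M)
    nz = ℕₚ.m*n≢0 (suc t) M
    r = recip (suc t ℕ.* M) {{nz}}

  block-upper : ∀ t .{{_ : ℕ.NonZero t}} → segment (t ℕ.* M) M ≤ recip t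
  block-upper t {{t≢0}} = begin
    segment (t ℕ.* M) M
      ≤⟨ ∑-mono M (λ i _ → recip-mono (t ℕ.* M) (suc (t ℕ.* M ℕ.+ i)) {{nz}}
           (ℕₚ.m≤n⇒m≤1+n (ℕₚ.m≤m+n (t ℕ.* M) i))) ⟩
    ∑[ i < M ] r                      ≡⟨ ∑-const M r ⟩
    fromℕ M * r                       ≡⟨ recip-scale t {{t≢0}} {{nz}} ⟩
    recip t                           ∎
    where
    open ≤-Reasoning
    nz : ℕ.NonZero (t ℕ.* M)
    nz = ℕₚ.m*n≢0 t M
    r = recip (t ℕ.* M) {{nz}}

  segment-refine : ∀ s l → segment (s ℕ.* M) (suc l ℕ.* M) ≡
                   segment (s ℕ.* M) (l ℕ.* M) + segment ((s ℕ.+ l) ℕ.* M) M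
  segment-refine s l = trans (cong (segment (s ℕ.* M)) (ℕₚ.+-comm M (l ℕ.* M)))
    (trans (segment-split (s ℕ.* M) (l ℕ.* M) M)
      (cong (λ z → segment (s ℕ.* M) (l ℕ.* M) + segment z M) (sym (ℕₚ.*-distribʳ-+ M s l))))

  segment-lower : ∀ s l → segment s l ≤ segment (s ℕ.* M) (l ℕ.* M)
  segment-lower s zero    = ≤-refl
  segment-lower s (suc l) = subst (segment s (suc l) ≤_) (sym (segment-refine s l))
    (+-mono-≤ (segment-lower s l) (block-lower (s ℕ.+ l)))

  segment-upper : ∀ s .{{_ : ℕ.NonZero s}} l →
    segment (s ℕ.* M) (l ℕ.* M) + recip (s ℕ.+ l) {{ℕ.>-nonZero (ℕₚ.m≤n⇒m≤n+o l (ℕ.>-nonZero⁻¹ s))}}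
    ≤ segment s l + recip s
  segment-upper s@(suc s′) zero    = ≤-reflexive (cong (λ z → 0ℚ + recip (suc z)) (ℕₚ.+-identityʳ s′))
  segment-upper s@(suc s′) (suc l) = begin
    segment (s ℕ.* M) (suc l ℕ.* M) + recip (s ℕ.+ suc l)
      ≡⟨ cong₂ _+_ (segment-refine s l) (cong (λ z → recip (suc z)) (ℕₚ.+-suc s′ l)) ⟩
    A + segment ((s ℕ.+ l) ℕ.* M) M + c
      ≤⟨ +-monoˡ-≤ c (+-monoʳ-≤ A (block-upper (s ℕ.+ l))) ⟩
    A + recip (s ℕ.+ l) + c
      ≤⟨ +-monoˡ-≤ c (segment-upper s l) ⟩
    segment s l + recip s + c
      ≡⟨ solve 3 (λ a b c → a :+ b :+ c := a :+ c :+ b) refl (segment s l) (recip s) c ⟩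
    segment s (suc l) + recip s ∎
    where
    open ≤-Reasoning
    A = segment (s ℕ.* M) (l ℕ.* M)
    c = recip (suc (s ℕ.+ l))

  segment-close : ∀ s .{{_ : ℕ.NonZero s}} l →
                  ∣ segment s l - segment (s ℕ.* M) (l ℕ.* M) ∣ ≤ recip s
  segment-close s@(suc s′) l = ∣-∣-between (segment-lower s l)
    (≤-trans (subst (_≤ segment (s ℕ.* M) (l ℕ.* M) + recip (s ℕ.+ l)) (+-identityʳ _)
               (+-monoʳ-≤ (segment (s ℕ.* M) (l ℕ.* M)) (0≤/ 1 (s ℕ.+ l))))
             (segment-upper s l))

-- log n = ∫₁ⁿ dt/t.  With M = m + 1, the m-th approximation is the right Riemann sum
-- of mesh 1/M:  Σ_{0 ≤ i < (n−1)M} (1/M) · 1/(1 + (i+1)/M) = Σ_i 1/(M + i + 1).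
log : (n : ℕ) → .{{ℕ.NonZero n}} → ℝ
log n = mkℝ (λ m → segment (suc m) (ℕ.pred n ℕ.* suc m)) λ {ε} 0<ε →
  let r , r≤ = small-recip (half-pos 0<ε)
      p = ℕ.pred n
  in r , λ {m} {m′} hm hm′ →
     let M = suc m; M′ = suc m′
         a = segment M (p ℕ.* M); b = segment M′ (p ℕ.* M′)
         c = segment (M ℕ.* M′) (p ℕ.* M ℕ.* M′)
         swap = cong₂ segment (ℕₚ.*-comm M′ M)
                  (trans (ℕₚ.*-assoc p M′ M)
                    (trans (cong (p ℕ.*_) (ℕₚ.*-comm M′ M)) (sym (ℕₚ.*-assoc p M M′))))
     in ≤-trans (∣-∣-triangle a c b)
          (≤-trans
            (+-mono-≤
              (≤-trans (segment-close M′ M (p ℕ.* M))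
                (≤-trans (recip-mono (suc r) M (s≤s hm)) r≤))
              (≤-trans (subst (λ z → ∣ z - b ∣ ≤ recip M′) swap
                         (subst (_≤ recip M′) (∣-∣-comm b _) (segment-close M M′ (p ℕ.* M′))))
                (≤-trans (recip-mono (suc r) M′ (s≤s hm′)) r≤)))
            (≤-reflexive (½+½ ε)))

harmonic-log : ℕ → ℝ
harmonic-log n = fromℚ (harmonic (suc n)) -ᴿ log (suc n)

harmonic-log-cauchy : Cauchyᴿ harmonic-log
harmonic-log-cauchy = Cauchyᴿ-≤ harmonic-log λ {ε} 0<ε →
  let r , r≤ = small-recip 0<ε
  in r , λ {k} d hk → 0 , λ {m} _ →
     let M = suc m
         H = harmonic (suc k); h = segment (suc k) d
         L = segment M (k ℕ.* M); l = segment (suc k ℕ.* M) (d ℕ.* M)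
     in begin
       ∣ (H + - L) - (harmonic (suc k ℕ.+ d) + - segment M ((k ℕ.+ d) ℕ.* M)) ∣
         ≡⟨ cong₂ (λ u v → ∣ (H + - L) - (u + - v) ∣) (segment-split 0 (suc k) d)
              (trans (cong (segment M) (ℕₚ.*-distribʳ-+ M k d))
                (segment-split M (k ℕ.* M) (d ℕ.* M))) ⟩
       ∣ (H + - L) - ((H + h) + - (L + l)) ∣
         ≡⟨ cong ∣_∣ (solve 4 (λ H L h l → (H :+ :- L) :- ((H :+ h) :+ :- (L :+ l)) := l :- h)
                            refl H L h l) ⟩
       ∣ l - h ∣
         ≡⟨ ∣-∣-comm l h ⟩
       ∣ h - l ∣
         ≤⟨ segment-close M (suc k) d ⟩
       recip (suc k)
         ≤⟨ recip-mono (suc r) (suc k) (s≤s hk) ⟩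
       recip (suc r)
         ≤⟨ r≤ ⟩
       ε ∎
  where open ≤-Reasoning

γ : ℝ
γ = lim harmonic-log harmonic-log-cauchy

------------------------------------------------------------------------
-- Polynomials over 𝔽₂

-- 𝔽₂ is Bool with addition _xor_ and multiplication _∧_.  A polynomial is its list of
-- coefficients, constant term first; trailing zeros are allowed, so lists are compared
-- by _≈_.
Poly : Set
Poly = List Bool

coeff : Poly → ℕ → Bool
coeff []      _       = false
coeff (a ∷ p) zero    = a
coeff (a ∷ p) (suc i) = coeff p i

infix 4 _≈_
_≈_ : Poly → Poly → Set
p ≈ q = ∀ i → coeff p i ≡ coeff q i

infixl 6 _+ᴾ_
_+ᴾ_ : Poly → Poly → Poly
[]      +ᴾ q       = q
(a ∷ p) +ᴾ []      = a ∷ p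
(a ∷ p) +ᴾ (b ∷ q) = (a xor b) ∷ (p +ᴾ q)

infixl 7 _*ᴾ_
_*ᴾ_ : Poly → Poly → Poly
[]      *ᴾ q = []
(a ∷ p) *ᴾ q = map (a ∧_) q +ᴾ (false ∷ (p *ᴾ q))

*ᴾ-rawMagma : RawMagma _ _
*ᴾ-rawMagma = record { Carrier = Poly ; _≈_ = _≈_ ; _∙_ = _*ᴾ_ }

-- The monic polynomial x^deg + Σ_{i < deg} (lower i) x^i; this representation is unique,
-- so equality of monic polynomials is _≡_.
record Monic : Set where
  constructor monic
  field
    deg   : ℕ
    lower : Vec Bool deg

  toPoly : Poly
  toPoly = toList lower ++ (true ∷ [])
open Monic public

𝟙 : Monic
𝟙 = monic 0 []

infix 4 _∣_
_∣_ : Monic → Monic → Set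
a ∣ b = MagmaDefs._∣_ *ᴾ-rawMagma (toPoly a) (toPoly b)

private
  variable
    ℓ : Level

Primitive : Pred Monic ℓ → Set ℓ
Primitive A = ∀ {a b} → a ∈ A → b ∈ A → a ≢ b → ¬ (a ∣ b)

------------------------------------------------------------------------
-- The sum 𝓕

PositiveDegree : Pred Monic _
PositiveDegree a = ℕ.NonZero (deg a)

term : (a : Monic) → .(PositiveDegree a) → ℚ
term a nz = recip (2 ℕ.^ deg a ℕ.* deg a)
  {{ℕₚ.m*n≢0 (2 ℕ.^ deg a) (deg a) {{ℕₚ.m^n≢0 2 (deg a)}} {{nz}}}}

finiteSum : ∀ {as} → All PositiveDegree as → ℚ
finiteSum []                 = 0ℚ
finiteSum (_∷_ {x = a} nz nzs) = term a nz + finiteSum nzs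

-- A series of nonnegative terms is the supremum of its finite partial sums, and a
-- supremum lies strictly below c when some number strictly below c is an upper bound.
-- The first field makes every term meaningful: the constant 1 would contribute 1/0.
record 𝓕_<_ (A : Pred Monic ℓ) (c : ℝ) : Set ℓ where
  field
    positiveDegree : ∀ {a} → a ∈ A → PositiveDegree a
    bound          : ℚ
    bound<c        : fromℚ bound <ᴿ c
    partialSums    : ∀ {as} → Unique as → All (_∈ A) as → (nzs : All PositiveDegree as) →
                     finiteSum nzs ≤ bound

{-# OPTIONS --safe #-}

-- Let w(f) = 1/(2ⁿn) for monic f of degree n, and let Λ be the von Mangoldt function on
-- 𝔽₂[x], so that Σ_{q ∣ f} Λ(q) = deg f and hence Σ_{deg q = k} Λ(q) = 2ᵏ.  Emit a mass
-- w(a) at every a in a finite primitive set S and let mass move from f to f/q with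
-- probability Λ(q)/deg f.  Mass is conserved and ends up at 1.  The mass at g ≠ 1 never
-- exceeds w(g): if g ∈ S nothing flows in, since S is an antichain, and otherwise the inflow
-- is at most Σ_q w(gq) Λ(q)/deg(gq) = 2⁻ⁿ Σ_{k ≥ 1} 1/(n+k)² ≤ w(g) with n = deg g.  The same
-- computation at g = 1 gives 𝓕(S) ≤ Σ_{k ≥ 1} 1/k² = π²/6 < 1 + 1/4 + 1/9 + 1/3 = 61/36.  Finally
-- γ ≥ H₂ − log 3 ≥ 17/50 and e^γ ≥ 1 + γ + γ²/2 give 61/36 < 1 + e^γ/2.
module Submission where

open import Defs
import Algebra.Definitions.RawMagma as MagmaDefs
open import Data.Bool.Base using (Bool; true; false; _xor_; _∧_)
open import Data.Bool.Properties using (xor-assoc; xor-comm; xor-identityʳ; xor-same;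
  ∧-assoc; ∧-comm; ∧-zeroʳ; ∧-distribˡ-xor; ∧-distribʳ-xor) renaming (_≟_ to _≟ᴮ_)
open import Data.Empty using (⊥; ⊥-elim)
open import Data.Fin.Base using (toℕ)
import Data.Integer.Base as ℤ
open import Data.List.Base using (List; []; _∷_; _++_; map; filter)
open import Data.List.Extrema.Nat using (max; xs≤max)
import Data.List.Membership.DecPropositional as DecMembership
open import Data.List.Membership.Propositional using (_∈_; find; lose)
open import Data.List.Membership.Propositional.Properties
  using (∈-filter⁺; ∈-filter⁻; ∈-map⁺; ∈-map⁻; ∈-++⁺ˡ; ∈-++⁺ʳ; ∈-++⁻)
open import Data.List.Relation.Unary.All as All using (All; []; _∷_)
open import Data.List.Relation.Unary.AllPairs using ([]; _∷_)
open import Data.List.Relation.Unary.Any using (any?; here; there)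
open import Data.List.Relation.Unary.Unique.Propositional using (Unique)
import Data.List.Relation.Unary.Unique.Propositional.Properties as Uniqueₚ
open import Data.Nat.Base as ℕ using (ℕ; zero; suc; z≤n; s≤s)
open import Data.Nat.Induction using (<-wellFounded)
import Data.Nat.Properties as ℕₚ
open import Data.Product using (∃-syntax; _×_; _,_; proj₁; proj₂)
open import Data.Rational.Base hiding (NonZero; ∣_∣)
open import Data.Rational.Properties hiding (_≟_)
open import Data.Rational.Solver using (module +-*-Solver)
open import Data.Sum.Base using (_⊎_; inj₁; inj₂)
open import Data.Vec.Base using (Vec; []; _∷_; toList; tabulate; replicate)
open import Data.Vec.Properties using (≡-dec)
open import Function.Base using (_∘_)
open import Induction.WellFounded using (Acc; acc)
open import Level using (Level)
open import Relation.Binary.PropositionalEquality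
open import Relation.Nullary using (¬_; Dec; yes; no; contradiction)
open import Relation.Nullary.Decidable using (¬?; _×-dec_; toWitness)
open import Relation.Unary using (Pred; _≐_; ｛_｝)

open +-*-Solver using (solve; _:=_; _:+_; _:*_; :-_; _:-_; con)
open MagmaDefs *ᴾ-rawMagma using (_,_)

-- The jump probabilities Λ(q)/deg f make the inflow summable: the bound `weight` depends on the
-- degree alone, so of the moves of degree k only the total of Λ over that degree matters. The flow
-- involves no limit. With `N` the largest degree in S, no mass ever sits above degree `N`, so
-- polynomials, irreducibles and exponents are all cut off at `N`, while the final bound 61/36
-- depends neither on `N` nor on S. A strict bound for each finite sum would not give a strict bound
-- for the supremum, so strictness comes from a numerical gap: 61/36 ≈ 1.6944 against the lower
-- bound 1.6989 that γ ≥ 17/50 yields for 1 + e^γ/2. The gap is narrow, and the constants of the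
-- numerical part are tuned to it.

private
  variable
    ℓ : Level
    A B : Set ℓ
    P Q : Set ℓ

-- Polynomials over 𝔽₂

-- _≈_ unfolds to a Π-type, from which Agda cannot recover the two polynomials.
infix 4 _≋_
record _≋_ (p q : Poly) : Set where
  constructor pointwise
  field at : p ≈ q
open _≋_

record IsMonic (n : ℕ) (p : Poly) : Set where
  constructor isMonic
  field
    lead  : coeff p n ≡ true
    above : ∀ {i} → n ℕ.< i → coeff p i ≡ false
open IsMonic

≋-refl : ∀ {p} → p ≋ p
≋-refl .at i = refl

≋-sym : ∀ {p q} → p ≋ q → q ≋ p
≋-sym h .at i = sym (h .at i)

≋-trans : ∀ {p q r} → p ≋ q → q ≋ r → p ≋ r
≋-trans h k .at i = trans (h .at i) (k .at i)

∷-cong : ∀ {p q} a → p ≋ q → (a ∷ p) ≋ (a ∷ q)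
∷-cong a h .at zero    = refl
∷-cong a h .at (suc i) = h .at i

∷-zero : ∀ {p} → p ≋ [] → (false ∷ p) ≋ []
∷-zero h .at zero    = refl
∷-zero h .at (suc i) = h .at i

coeff-+ : ∀ p q i → coeff (p +ᴾ q) i ≡ coeff p i xor coeff q i
coeff-+ []      q       i       = refl
coeff-+ (a ∷ p) []      i       = sym (xor-identityʳ _)
coeff-+ (a ∷ p) (b ∷ q) zero    = refl
coeff-+ (a ∷ p) (b ∷ q) (suc i) = coeff-+ p q i

coeff-scale : ∀ a p i → coeff (map (a ∧_) p) i ≡ a ∧ coeff p i
coeff-scale a []      i       = sym (∧-zeroʳ a)
coeff-scale a (b ∷ p) zero    = refl
coeff-scale a (b ∷ p) (suc i) = coeff-scale a p i

coeff-∷ : ∀ a p q i → coeff ((a ∷ p) *ᴾ q) i ≡ (a ∧ coeff q i) xor coeff (false ∷ (p *ᴾ q)) i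
coeff-∷ a p q i = trans (coeff-+ (map (a ∧_) q) _ i)
  (cong (_xor coeff (false ∷ (p *ᴾ q)) i) (coeff-scale a q i))

+ᴾ-cong : ∀ {p p′ q q′} → p ≋ p′ → q ≋ q′ → p +ᴾ q ≋ p′ +ᴾ q′
+ᴾ-cong {p} {p′} {q} {q′} h k .at i =
  trans (coeff-+ p q i) (trans (cong₂ _xor_ (h .at i) (k .at i)) (sym (coeff-+ p′ q′ i)))

+ᴾ-comm : ∀ p q → p +ᴾ q ≋ q +ᴾ p
+ᴾ-comm p q .at i = trans (coeff-+ p q i) (trans (xor-comm (coeff p i) _) (sym (coeff-+ q p i)))

+ᴾ-assoc : ∀ p q r → (p +ᴾ q) +ᴾ r ≋ p +ᴾ (q +ᴾ r)
+ᴾ-assoc p q r .at i = begin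
  coeff ((p +ᴾ q) +ᴾ r) i                 ≡⟨ coeff-+ (p +ᴾ q) r i ⟩
  coeff (p +ᴾ q) i xor coeff r i          ≡⟨ cong (_xor coeff r i) (coeff-+ p q i) ⟩
  (coeff p i xor coeff q i) xor coeff r i ≡⟨ xor-assoc (coeff p i) _ _ ⟩
  coeff p i xor (coeff q i xor coeff r i) ≡⟨ cong (coeff p i xor_) (coeff-+ q r i) ⟨
  coeff p i xor coeff (q +ᴾ r) i          ≡⟨ coeff-+ p (q +ᴾ r) i ⟨
  coeff (p +ᴾ (q +ᴾ r)) i                 ∎
  where open ≡-Reasoning

+ᴾ-self : ∀ p → p +ᴾ p ≋ []
+ᴾ-self p .at i = trans (coeff-+ p p i) (xor-same (coeff p i))

-- In characteristic 2 addition is subtraction; two polynomials are proved equal by showing that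
-- their sum vanishes.
+ᴾ-≋[] : ∀ p q → p +ᴾ q ≋ [] → p ≋ q
+ᴾ-≋[] p q h .at i = xor-false (trans (sym (coeff-+ p q i)) (h .at i))
  where
  xor-false : ∀ {x y} → x xor y ≡ false → x ≡ y
  xor-false {true}  {true}  _ = refl
  xor-false {false} {false} _ = refl

*ᴾ-congʳ : ∀ p {q q′} → q ≋ q′ → p *ᴾ q ≋ p *ᴾ q′
*ᴾ-congʳ []      h = ≋-refl
*ᴾ-congʳ (a ∷ p) {q} {q′} h .at i = begin
  coeff ((a ∷ p) *ᴾ q) i                               ≡⟨ coeff-∷ a p q i ⟩
  (a ∧ coeff q i) xor coeff (false ∷ (p *ᴾ q)) i
    ≡⟨ cong₂ (λ b c → (a ∧ b) xor c) (h .at i) (∷-cong false (*ᴾ-congʳ p h) .at i) ⟩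
  (a ∧ coeff q′ i) xor coeff (false ∷ (p *ᴾ q′)) i     ≡⟨ coeff-∷ a p q′ i ⟨
  coeff ((a ∷ p) *ᴾ q′) i                              ∎
  where open ≡-Reasoning

*ᴾ-zeroʳ : ∀ p → p *ᴾ [] ≋ []
*ᴾ-zeroʳ []      = ≋-refl
*ᴾ-zeroʳ (a ∷ p) = ∷-zero (*ᴾ-zeroʳ p)

xor-interchange : ∀ a b c d → (a xor b) xor (c xor d) ≡ (a xor c) xor (b xor d)
xor-interchange a b c d = begin
  (a xor b) xor (c xor d) ≡⟨ xor-assoc a b _ ⟩
  a xor (b xor (c xor d)) ≡⟨ cong (a xor_) (xor-assoc b c d) ⟨
  a xor ((b xor c) xor d) ≡⟨ cong (λ z → a xor (z xor d)) (xor-comm b c) ⟩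
  a xor ((c xor b) xor d) ≡⟨ cong (a xor_) (xor-assoc c b d) ⟩
  a xor (c xor (b xor d)) ≡⟨ xor-assoc a c _ ⟨
  (a xor c) xor (b xor d) ∎
  where open ≡-Reasoning

*ᴾ-distribʳ : ∀ q p p′ → (p +ᴾ p′) *ᴾ q ≋ p *ᴾ q +ᴾ p′ *ᴾ q
*ᴾ-distribʳ q []      p′       = ≋-refl
*ᴾ-distribʳ q (a ∷ p) []       = +ᴾ-comm [] ((a ∷ p) *ᴾ q)
*ᴾ-distribʳ q (a ∷ p) (b ∷ p′) .at i = begin
  coeff (((a xor b) ∷ (p +ᴾ p′)) *ᴾ q) i
    ≡⟨ coeff-∷ (a xor b) (p +ᴾ p′) q i ⟩
  ((a xor b) ∧ coeff q i) xor coeff (false ∷ ((p +ᴾ p′) *ᴾ q)) i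
    ≡⟨ cong₂ _xor_ (∧-distribʳ-xor (coeff q i) a b)
         (trans (∷-cong false (*ᴾ-distribʳ q p p′) .at i)
           (coeff-+ (false ∷ (p *ᴾ q)) (false ∷ (p′ *ᴾ q)) i)) ⟩
  ((a ∧ coeff q i) xor (b ∧ coeff q i)) xor
    (coeff (false ∷ (p *ᴾ q)) i xor coeff (false ∷ (p′ *ᴾ q)) i)
    ≡⟨ xor-interchange (a ∧ coeff q i) _ _ _ ⟩
  ((a ∧ coeff q i) xor coeff (false ∷ (p *ᴾ q)) i) xor
    ((b ∧ coeff q i) xor coeff (false ∷ (p′ *ᴾ q)) i)
    ≡⟨ cong₂ _xor_ (coeff-∷ a p q i) (coeff-∷ b p′ q i) ⟨
  coeff ((a ∷ p) *ᴾ q) i xor coeff ((b ∷ p′) *ᴾ q) i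
    ≡⟨ coeff-+ ((a ∷ p) *ᴾ q) _ i ⟨
  coeff ((a ∷ p) *ᴾ q +ᴾ (b ∷ p′) *ᴾ q) i ∎
  where open ≡-Reasoning

-- Multiplication recurses on its left factor; this mirrored recursion is what commutativity needs.
*ᴾ-∷ʳ : ∀ p b q → p *ᴾ (b ∷ q) ≋ map (b ∧_) p +ᴾ (false ∷ (p *ᴾ q))
*ᴾ-∷ʳ []      b q = ≋-sym (∷-zero ≋-refl)
*ᴾ-∷ʳ (a ∷ p) b q .at zero    = cong (_xor false) (∧-comm a b)
*ᴾ-∷ʳ (a ∷ p) b q .at (suc i) = begin
  coeff (map (a ∧_) q +ᴾ p *ᴾ (b ∷ q)) i
    ≡⟨ +ᴾ-cong {map (a ∧_) q} ≋-refl (*ᴾ-∷ʳ p b q) .at i ⟩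
  coeff (map (a ∧_) q +ᴾ (map (b ∧_) p +ᴾ (false ∷ (p *ᴾ q)))) i
    ≡⟨ +ᴾ-assoc (map (a ∧_) q) (map (b ∧_) p) _ .at i ⟨
  coeff ((map (a ∧_) q +ᴾ map (b ∧_) p) +ᴾ (false ∷ (p *ᴾ q))) i
    ≡⟨ +ᴾ-cong (+ᴾ-comm (map (a ∧_) q) (map (b ∧_) p)) ≋-refl .at i ⟩
  coeff ((map (b ∧_) p +ᴾ map (a ∧_) q) +ᴾ (false ∷ (p *ᴾ q))) i
    ≡⟨ +ᴾ-assoc (map (b ∧_) p) (map (a ∧_) q) _ .at i ⟩
  coeff (map (b ∧_) p +ᴾ (map (a ∧_) q +ᴾ (false ∷ (p *ᴾ q)))) i ∎
  where open ≡-Reasoning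

*ᴾ-comm : ∀ p q → p *ᴾ q ≋ q *ᴾ p
*ᴾ-comm []      q = ≋-sym (*ᴾ-zeroʳ q)
*ᴾ-comm (a ∷ p) q = ≋-trans
  (+ᴾ-cong {map (a ∧_) q} ≋-refl (∷-cong false (*ᴾ-comm p q))) (≋-sym (*ᴾ-∷ʳ q a p))

*ᴾ-cong : ∀ {p p′ q q′} → p ≋ p′ → q ≋ q′ → p *ᴾ q ≋ p′ *ᴾ q′
*ᴾ-cong {p} {p′} {q} {q′} h k = ≋-trans (*ᴾ-congʳ p k)
  (≋-trans (*ᴾ-comm p q′) (≋-trans (*ᴾ-congʳ q′ h) (*ᴾ-comm q′ p′)))

scale-* : ∀ a q r → map (a ∧_) q *ᴾ r ≋ map (a ∧_) (q *ᴾ r)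
scale-* a []      r .at i = refl
scale-* a (b ∷ q) r .at i = begin
  coeff (((a ∧ b) ∷ map (a ∧_) q) *ᴾ r) i
    ≡⟨ coeff-∷ (a ∧ b) (map (a ∧_) q) r i ⟩
  ((a ∧ b) ∧ coeff r i) xor coeff (false ∷ (map (a ∧_) q *ᴾ r)) i
    ≡⟨ cong₂ _xor_ (∧-assoc a b _) (tail i) ⟩
  (a ∧ (b ∧ coeff r i)) xor (a ∧ coeff (false ∷ (q *ᴾ r)) i)
    ≡⟨ ∧-distribˡ-xor a _ _ ⟨
  a ∧ ((b ∧ coeff r i) xor coeff (false ∷ (q *ᴾ r)) i)
    ≡⟨ cong (a ∧_) (coeff-∷ b q r i) ⟨
  a ∧ coeff ((b ∷ q) *ᴾ r) i
    ≡⟨ coeff-scale a ((b ∷ q) *ᴾ r) i ⟨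
  coeff (map (a ∧_) ((b ∷ q) *ᴾ r)) i ∎
  where
  open ≡-Reasoning
  tail : ∀ i → coeff (false ∷ (map (a ∧_) q *ᴾ r)) i ≡ a ∧ coeff (false ∷ (q *ᴾ r)) i
  tail zero    = sym (∧-zeroʳ a)
  tail (suc i) = trans (scale-* a q r .at i) (coeff-scale a (q *ᴾ r) i)

scale-false : ∀ q → map (false ∧_) q ≋ []
scale-false q .at i = coeff-scale false q i

*ᴾ-assoc : ∀ p q r → (p *ᴾ q) *ᴾ r ≋ p *ᴾ (q *ᴾ r)
*ᴾ-assoc []      q r = ≋-refl
*ᴾ-assoc (a ∷ p) q r = ≋-trans (*ᴾ-distribʳ r (map (a ∧_) q) (false ∷ (p *ᴾ q)))
  (+ᴾ-cong (scale-* a q r)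
    (≋-trans (+ᴾ-cong (scale-false r) ≋-refl) (∷-cong false (*ᴾ-assoc p q r))))

*ᴾ-identityˡ : ∀ p → (true ∷ []) *ᴾ p ≋ p
*ᴾ-identityˡ p .at i = trans (coeff-∷ true [] p i)
  (trans (cong (coeff p i xor_) (∷-zero {[]} ≋-refl .at i)) (xor-identityʳ _))

-- Monic polynomials of a given degree

IsMonic-resp : ∀ {n p q} → p ≋ q → IsMonic n p → IsMonic n q
IsMonic-resp h (isMonic t z) =
  isMonic (trans (sym (h .at _)) t) λ n<i → trans (sym (h .at _)) (z n<i)

toPoly-isMonic : ∀ a → IsMonic (deg a) (toPoly a)
toPoly-isMonic (monic n v) = go v
  where
  go : ∀ {n} (v : Vec Bool n) → IsMonic n (toList v ++ (true ∷ []))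
  go []      = isMonic refl λ { (s≤s _) → refl }
  go (b ∷ v) = isMonic (go v .lead) λ { (s≤s n<i) → go v .above n<i }

*ᴾ-isMonic : ∀ n p {m q} → IsMonic n p → IsMonic m q → IsMonic (n ℕ.+ m) (p *ᴾ q)
*ᴾ-isMonic zero    []      (isMonic () _) _
*ᴾ-isMonic (suc n) []      (isMonic () _) _
*ᴾ-isMonic zero    (a ∷ p) {m} {q} (isMonic t z) hq = IsMonic-resp (≋-sym eq) hq
  where
  p≋1 : (a ∷ p) ≋ (true ∷ [])
  p≋1 .at zero    = t
  p≋1 .at (suc i) = z (s≤s z≤n)

  eq : (a ∷ p) *ᴾ q ≋ q
  eq = ≋-trans (*ᴾ-cong p≋1 ≋-refl) (*ᴾ-identityˡ q)
*ᴾ-isMonic (suc n) (a ∷ p) {m} {q} (isMonic t z) hq = isMonic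
  (shift (s≤s (ℕₚ.m≤n+m m n)) (ih .lead))
  λ { {suc i} (s≤s h) → shift (s≤s (ℕₚ.≤-trans (ℕₚ.m≤n+m m n) (ℕₚ.<⇒≤ h))) (ih .above h) }
  where
  ih : IsMonic (n ℕ.+ m) (p *ᴾ q)
  ih = *ᴾ-isMonic n p (isMonic t λ n<i → z (s≤s n<i)) hq

  -- At a position `suc i` beyond `m` the head contributes `a ∧ false`, so only the shifted product
  -- `p *ᴾ q` counts.
  shift : ∀ {i b} → m ℕ.< suc i → coeff (p *ᴾ q) i ≡ b → coeff ((a ∷ p) *ᴾ q) (suc i) ≡ b
  shift {i} m<i h = trans (coeff-∷ a p q (suc i))
    (trans (cong (λ c → (a ∧ c) xor coeff (p *ᴾ q) i) (hq .above m<i))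
      (trans (cong (_xor coeff (p *ᴾ q) i) (∧-zeroʳ a)) h))

fromCoeffs : (n : ℕ) → Poly → Monic
fromCoeffs n p = monic n (tabulate (λ i → coeff p (toℕ i)))

toPoly-fromCoeffs : ∀ n {p} → IsMonic n p → toPoly (fromCoeffs n p) ≋ p
toPoly-fromCoeffs n {p} = go n p
  where
  go : ∀ n p → IsMonic n p →
       toList (tabulate {n = n} (λ i → coeff p (toℕ i))) ++ (true ∷ []) ≋ p
  go zero    []      (isMonic () _)
  go zero    (a ∷ p) h .at zero    = sym (h .lead)
  go zero    (a ∷ p) h .at (suc i) = sym (h .above (s≤s z≤n))
  go (suc n) []      (isMonic () _)
  go (suc n) (a ∷ p) h .at zero    = refl
  go (suc n) (a ∷ p) h .at (suc i) = go n p (isMonic (h .lead) λ n<i → h .above (s≤s n<i)) .at i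

-- The only nonzero scalar of 𝔽₂ is 1, so every nonzero polynomial is monic. The degree bound makes
-- remainders smaller in the Euclidean algorithm.
zero-or-monic : ∀ n p → (∀ {i} → n ℕ.≤ i → coeff p i ≡ false) →
                p ≋ [] ⊎ ∃[ a ] (deg a ℕ.< n × p ≋ toPoly a)
zero-or-monic zero    p z = inj₁ (pointwise λ i → z z≤n)
zero-or-monic (suc n) p z with coeff p n in eq
... | true  = inj₂ (fromCoeffs n p , ℕₚ.≤-refl , ≋-sym (toPoly-fromCoeffs n (isMonic eq z)))
... | false with zero-or-monic n p (λ {i} n≤i → below i n≤i)
  where
  below : ∀ i → n ℕ.≤ i → coeff p i ≡ false
  below i n≤i with ℕₚ.m≤n⇒m<n∨m≡n n≤i
  ... | inj₁ n<i  = z n<i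
  ... | inj₂ refl = eq
...   | inj₁ p≋0           = inj₁ p≋0
...   | inj₂ (a , a<n , e) = inj₂ (a , ℕₚ.m<n⇒m<1+n a<n , e)

coeff-beyond : ∀ p → ∃[ n ] (∀ {i} → n ℕ.≤ i → coeff p i ≡ false)
coeff-beyond []      = 0 , λ _ → refl
coeff-beyond (a ∷ p) = let n , h = coeff-beyond p in suc n , λ { (s≤s n≤i) → h n≤i }

[]≉toPoly : ∀ a → ¬ [] ≋ toPoly a
[]≉toPoly a h with trans (h .at (deg a)) (toPoly-isMonic a .lead)
... | ()

toPoly-injective : ∀ {a b} → toPoly a ≋ toPoly b → a ≡ b
toPoly-injective {monic _ v} {monic _ w} h = go v w h
  where
  tail : ∀ {m n} b {v : Vec Bool m} {w : Vec Bool n} → monic m v ≡ monic n w →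
         monic (suc m) (b ∷ v) ≡ monic (suc n) (b ∷ w)
  tail b refl = refl

  go : ∀ {m n} (v : Vec Bool m) (w : Vec Bool n) →
       toList v ++ (true ∷ []) ≋ toList w ++ (true ∷ []) → monic m v ≡ monic n w
  go []      []      h = refl
  go []      (c ∷ w) h = ⊥-elim ([]≉toPoly (monic _ w) (pointwise (h .at ∘ suc)))
  go (b ∷ v) []      h = ⊥-elim ([]≉toPoly (monic _ v)
    (≋-sym {toList v ++ (true ∷ [])} {[]} (pointwise (h .at ∘ suc))))
  go (b ∷ v) (c ∷ w) h with refl ← h .at 0 = tail b (go v w (pointwise (h .at ∘ suc)))

-- Products, cancellation and divisibility of monic polynomials

infixl 7 _·_
_·_ : Monic → Monic → Monic
a · b = fromCoeffs (deg a ℕ.+ deg b) (toPoly a *ᴾ toPoly b)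

toPoly-· : ∀ a b → toPoly (a · b) ≋ toPoly a *ᴾ toPoly b
toPoly-· a b = toPoly-fromCoeffs (deg a ℕ.+ deg b)
  (*ᴾ-isMonic (deg a) (toPoly a) (toPoly-isMonic a) (toPoly-isMonic b))

infix 4 _≟_
_≟_ : (a b : Monic) → Dec (a ≡ b)
monic m v ≟ monic n w with m ℕₚ.≟ n
... | no  m≢n  = no λ { refl → m≢n refl }
... | yes refl with ≡-dec _≟ᴮ_ v w
...   | yes refl = yes refl
...   | no  v≢w  = no λ { refl → v≢w refl }

·-comm : ∀ a b → a · b ≡ b · a
·-comm a b = toPoly-injective (≋-trans (toPoly-· a b)
  (≋-trans (*ᴾ-comm (toPoly a) (toPoly b)) (≋-sym (toPoly-· b a))))

·-assoc : ∀ a b c → (a · b) · c ≡ a · (b · c)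
·-assoc a b c = toPoly-injective (≋-trans (toPoly-· (a · b) c)
  (≋-trans (*ᴾ-cong (toPoly-· a b) ≋-refl)
  (≋-trans (*ᴾ-assoc (toPoly a) (toPoly b) (toPoly c))
  (≋-trans (*ᴾ-congʳ (toPoly a) (≋-sym (toPoly-· b c))) (≋-sym (toPoly-· a (b · c)))))))

·-identityʳ : ∀ a → a · 𝟙 ≡ a
·-identityʳ a = toPoly-injective (≋-trans (toPoly-· a 𝟙)
  (≋-trans (*ᴾ-comm (toPoly a) (toPoly 𝟙)) (*ᴾ-identityˡ (toPoly a))))

poly-cases : ∀ p → p ≋ [] ⊎ ∃[ a ] p ≋ toPoly a
poly-cases p with zero-or-monic _ p (proj₂ (coeff-beyond p))
... | inj₁ h           = inj₁ h
... | inj₂ (a , _ , h) = inj₂ (a , h)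

-- If `a` and `b` differed, their difference would be some monic `d`, and `d · c` would be both
-- monic and zero.
·-cancelʳ : ∀ {a b} c → a · c ≡ b · c → a ≡ b
·-cancelʳ {a} {b} c e with poly-cases (toPoly a +ᴾ toPoly b)
... | inj₁ h = toPoly-injective (+ᴾ-≋[] (toPoly a) _ h)
... | inj₂ (d , h) = contradiction (trans (sym (toPoly-isMonic (d · c) .lead)) (zero≋ .at _)) λ ()
  where
  zero≋ : toPoly (d · c) ≋ []
  zero≋ = ≋-trans (toPoly-· d c)
    (≋-trans (*ᴾ-cong {q = toPoly c} (≋-sym h) ≋-refl)
    (≋-trans (*ᴾ-distribʳ (toPoly c) (toPoly a) (toPoly b))
    (≋-trans (+ᴾ-cong {q = toPoly b *ᴾ toPoly c}
               (≋-trans (≋-sym (toPoly-· a c))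
                 (subst (λ z → toPoly z ≋ toPoly b *ᴾ toPoly c) (sym e) (toPoly-· b c)))
               ≋-refl)
             (+ᴾ-self (toPoly b *ᴾ toPoly c)))))

∣⇒≡· : ∀ {a b} → a ∣ b → ∃[ c ] b ≡ c · a
∣⇒≡· {a} {b} (q , e′) with poly-cases q
... | inj₁ h = contradiction
  (≋-trans (≋-sym (*ᴾ-cong {q = toPoly a} h ≋-refl)) (pointwise e′)) ([]≉toPoly b)
... | inj₂ (c , h) = c , toPoly-injective (≋-trans (≋-sym (pointwise e′))
  (≋-trans (*ᴾ-cong {q = toPoly a} h ≋-refl) (≋-sym (toPoly-· c a))))

∣-· : ∀ c a → a ∣ c · a
∣-· c a = toPoly c , ≋-sym (toPoly-· c a) .at

∣-·ˡ : ∀ c a → a ∣ a · c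
∣-·ˡ c a = subst (a ∣_) (·-comm c a) (∣-· c a)

∣-refl : ∀ a → a ∣ a
∣-refl a = subst (a ∣_) (trans (·-comm 𝟙 a) (·-identityʳ a)) (∣-· 𝟙 a)

∣-trans : ∀ {a b c} → a ∣ b → b ∣ c → a ∣ c
∣-trans {a} h k with ∣⇒≡· h | ∣⇒≡· k
... | e , refl | f , refl = subst (a ∣_) (·-assoc f e a) (∣-· (f · e) a)

∣⇒deg≤ : ∀ {a b} → a ∣ b → deg a ℕ.≤ deg b
∣⇒deg≤ {a} h with c , refl ← ∣⇒≡· h = ℕₚ.m≤n+m (deg a) (deg c)

∣-+ : ∀ {d a b c} → toPoly c ≋ toPoly a +ᴾ toPoly b → d ∣ a → d ∣ b → d ∣ c
∣-+ {d} {a} {b} h (q , e) (r , f) = q +ᴾ r ,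
  ≋-trans (*ᴾ-distribʳ (toPoly d) q r)
    (≋-trans (+ᴾ-cong (pointwise {q *ᴾ toPoly d} {toPoly a} e)
                       (pointwise {r *ᴾ toPoly d} {toPoly b} f)) (≋-sym h)) .at

-- The Euclidean algorithm and Euclid's lemma

X^_ : ℕ → Monic
X^ k = monic k (replicate k false)

-- Instead of Bézout coefficients, the Euclidean algorithm carries p ∣ _ · h along.
CommonDivisor : (p h a b : Monic) → Set
CommonDivisor p h a b = ∃[ d ] (d ∣ a × d ∣ b × p ∣ d · h)

module _ {p h : Monic} where

  -- One division step: adding a shifted copy of `b` cancels the leading term of `a`. The remainder
  -- `c` inherits `p ∣ c · h` by distributivity, and a common divisor of `c` and `b` divides `a` as
  -- well.
  reduce : ∀ a b → deg b ℕ.≤ deg a → p ∣ a · h → p ∣ b · h →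
           (∀ c → deg c ℕ.< deg a → p ∣ c · h → CommonDivisor p h c b) →
           CommonDivisor p h a b
  reduce a b b≤a pa pb rec with zero-or-monic (deg a) remainder vanishes
    where
    b′ = (X^ (deg a ℕ.∸ deg b)) · b
    remainder = toPoly a +ᴾ toPoly b′
    deg-b′ : deg b′ ≡ deg a
    deg-b′ = ℕₚ.m∸n+n≡m b≤a
    vanishes : ∀ {i} → deg a ℕ.≤ i → coeff remainder i ≡ false
    vanishes {i} a≤i with ℕₚ.m≤n⇒m<n∨m≡n a≤i
    ... | inj₁ a<i  = trans (coeff-+ (toPoly a) (toPoly b′) i)
      (cong₂ _xor_ (toPoly-isMonic a .above a<i)
                   (toPoly-isMonic b′ .above (subst (ℕ._< i) (sym deg-b′) a<i)))
    ... | inj₂ refl = trans (coeff-+ (toPoly a) (toPoly b′) i)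
      (cong₂ _xor_ (toPoly-isMonic a .lead)
        (subst (λ n → coeff (toPoly b′) n ≡ true) deg-b′ (toPoly-isMonic b′ .lead)))
  ... | inj₁ e = b , subst (b ∣_) (sym a≡b′) (∣-· (X^ (deg a ℕ.∸ deg b)) b) , ∣-refl b , pb
    where
    a≡b′ : a ≡ (X^ (deg a ℕ.∸ deg b)) · b
    a≡b′ = toPoly-injective (+ᴾ-≋[] (toPoly a) _ e)
  ... | inj₂ (c , c<a , e) = step (rec c c<a (∣-+ ch pa
    (∣-trans pb (subst (b · h ∣_) (sym (·-assoc x b h)) (∣-· x (b · h))))))
    where
    x = X^ (deg a ℕ.∸ deg b)
    ch : toPoly (c · h) ≋ toPoly (a · h) +ᴾ toPoly ((x · b) · h)
    ch = ≋-trans (toPoly-· c h)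
      (≋-trans (*ᴾ-cong {q = toPoly h} (≋-sym e) ≋-refl)
      (≋-trans (*ᴾ-distribʳ (toPoly h) (toPoly a) (toPoly (x · b)))
               (≋-sym (+ᴾ-cong (toPoly-· a h) (toPoly-· (x · b) h)))))
    -- Adding `x · b` twice changes nothing in characteristic 2.
    ac : toPoly a ≋ toPoly c +ᴾ toPoly (x · b)
    ac = ≋-trans (+ᴾ-comm [] (toPoly a))
      (≋-trans (+ᴾ-cong {toPoly a} ≋-refl (≋-sym (+ᴾ-self (toPoly (x · b)))))
      (≋-trans (≋-sym (+ᴾ-assoc (toPoly a) _ _))
               (+ᴾ-cong {q = toPoly (x · b)} e ≋-refl)))
    step : CommonDivisor p h c b → CommonDivisor p h a b
    step (d , dc , db , pd) = d , ∣-+ ac dc (∣-trans db (∣-· x b)) , db , pd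

  common-divisor : ∀ a b → Acc ℕ._<_ (deg a ℕ.+ deg b) → p ∣ a · h → p ∣ b · h →
                   CommonDivisor p h a b
  common-divisor a b (acc rec) pa pb with ℕₚ.≤-total (deg b) (deg a)
  ... | inj₁ b≤a = reduce a b b≤a pa pb λ c c<a pc →
    common-divisor c b (rec (ℕₚ.+-monoˡ-< (deg b) c<a)) pc pb
  ... | inj₂ a≤b with reduce b a a≤b pb pa (λ c c<b pc →
    common-divisor c a (rec (subst (deg c ℕ.+ deg a ℕ.<_) (ℕₚ.+-comm (deg b) (deg a))
      (ℕₚ.+-monoˡ-< (deg a) c<b))) pc pa)
  ...   | d , db , da , pd = d , da , db , pd

Irreducible : Monic → Set
Irreducible p = p ≢ 𝟙 × (∀ {d} → d ∣ p → d ≡ 𝟙 ⊎ d ≡ p)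

-- The algorithm runs on `p` and `a` with `h = b`, as `p` divides both `p · b` and `a · b`. The
-- common divisor it returns divides `p`: if it is `𝟙`, then `p ∣ b`; if it is `p`, then `p ∣ a`.
euclid : ∀ {p a b} → Irreducible p → p ∣ a · b → p ∣ a ⊎ p ∣ b
euclid {p} {a} {b} (_ , irr) pab
  with common-divisor {p} {b} p a (<-wellFounded _) (∣-·ˡ b p) pab
... | d , dp , da , pdb with irr dp
...   | inj₁ refl = inj₂ (subst (p ∣_) (trans (·-comm 𝟙 b) (·-identityʳ b)) pdb)
...   | inj₂ refl = inj₁ da

-- Sums over lists and indicators

∑ᴸ : List A → (A → ℚ) → ℚ
∑ᴸ []       f = 0ℚ
∑ᴸ (x ∷ xs) f = f x + ∑ᴸ xs f

∑ᴸ-cong-∈ : ∀ (xs : List A) {f g : A → ℚ} → (∀ {x} → x ∈ xs → f x ≡ g x) → ∑ᴸ xs f ≡ ∑ᴸ xs g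
∑ᴸ-cong-∈ []       h = refl
∑ᴸ-cong-∈ (x ∷ xs) h = cong₂ _+_ (h (here refl)) (∑ᴸ-cong-∈ xs (h ∘ there))

∑ᴸ-cong : ∀ (xs : List A) {f g : A → ℚ} → (∀ x → f x ≡ g x) → ∑ᴸ xs f ≡ ∑ᴸ xs g
∑ᴸ-cong xs h = ∑ᴸ-cong-∈ xs λ {x} _ → h x

∑ᴸ-mono : ∀ (xs : List A) {f g : A → ℚ} → (∀ x → f x ≤ g x) → ∑ᴸ xs f ≤ ∑ᴸ xs g
∑ᴸ-mono []       h = ≤-refl
∑ᴸ-mono (x ∷ xs) h = +-mono-≤ (h x) (∑ᴸ-mono xs h)

∑ᴸ-zero : ∀ (xs : List A) → ∑ᴸ xs (λ _ → 0ℚ) ≡ 0ℚ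
∑ᴸ-zero []       = refl
∑ᴸ-zero (x ∷ xs) = trans (+-identityˡ _) (∑ᴸ-zero xs)

∑ᴸ-nonneg : ∀ (xs : List A) {f : A → ℚ} → (∀ x → 0ℚ ≤ f x) → 0ℚ ≤ ∑ᴸ xs f
∑ᴸ-nonneg xs h = subst (_≤ ∑ᴸ xs _) (∑ᴸ-zero xs) (∑ᴸ-mono xs h)

∑ᴸ-+ : ∀ (xs : List A) (f g : A → ℚ) → ∑ᴸ xs (λ x → f x + g x) ≡ ∑ᴸ xs f + ∑ᴸ xs g
∑ᴸ-+ []       f g = refl
∑ᴸ-+ (x ∷ xs) f g = trans (cong (f x + g x +_) (∑ᴸ-+ xs f g))
  (solve 4 (λ a b c d → a :+ b :+ (c :+ d) := a :+ c :+ (b :+ d)) refl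
    (f x) (g x) (∑ᴸ xs f) (∑ᴸ xs g))

∑ᴸ-*ˡ : ∀ (xs : List A) c (f : A → ℚ) → ∑ᴸ xs (λ x → c * f x) ≡ c * ∑ᴸ xs f
∑ᴸ-*ˡ []       c f = sym (*-zeroʳ c)
∑ᴸ-*ˡ (x ∷ xs) c f = trans (cong (c * f x +_) (∑ᴸ-*ˡ xs c f)) (sym (*-distribˡ-+ c (f x) (∑ᴸ xs f)))

∑ᴸ-*ʳ : ∀ (xs : List A) c (f : A → ℚ) → ∑ᴸ xs (λ x → f x * c) ≡ ∑ᴸ xs f * c
∑ᴸ-*ʳ xs c f = trans (∑ᴸ-cong xs λ x → *-comm (f x) c) (trans (∑ᴸ-*ˡ xs c f) (*-comm c _))

∑ᴸ-swap : ∀ (xs : List A) (ys : List B) (f : A → B → ℚ) →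
          ∑ᴸ xs (λ x → ∑ᴸ ys (f x)) ≡ ∑ᴸ ys (λ y → ∑ᴸ xs (λ x → f x y))
∑ᴸ-swap []       ys f = sym (∑ᴸ-zero ys)
∑ᴸ-swap (x ∷ xs) ys f = trans (cong (∑ᴸ ys (f x) +_) (∑ᴸ-swap xs ys f))
  (sym (∑ᴸ-+ ys (f x) (λ y → ∑ᴸ xs (λ x → f x y))))

∑ᴸ-∑-swap : ∀ (xs : List A) n (f : A → ℕ → ℚ) →
            ∑ᴸ xs (λ x → ∑ n (f x)) ≡ ∑ n (λ i → ∑ᴸ xs (λ x → f x i))
∑ᴸ-∑-swap xs zero    f = ∑ᴸ-zero xs
∑ᴸ-∑-swap xs (suc n) f = trans (∑ᴸ-+ xs (λ x → ∑ n (f x)) (λ x → f x n))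
  (cong (_+ ∑ᴸ xs (λ x → f x n)) (∑ᴸ-∑-swap xs n f))

∑ᴸ-++ : ∀ (xs ys : List A) (f : A → ℚ) → ∑ᴸ (xs ++ ys) f ≡ ∑ᴸ xs f + ∑ᴸ ys f
∑ᴸ-++ []       ys f = sym (+-identityˡ _)
∑ᴸ-++ (x ∷ xs) ys f = trans (cong (f x +_) (∑ᴸ-++ xs ys f)) (sym (+-assoc (f x) _ _))

∑ᴸ-map : ∀ (g : A → B) xs (f : B → ℚ) → ∑ᴸ (map g xs) f ≡ ∑ᴸ xs (f ∘ g)
∑ᴸ-map g []       f = refl
∑ᴸ-map g (x ∷ xs) f = cong (f (g x) +_) (∑ᴸ-map g xs f)

∑-*ʳ : ∀ n c f → ∑ n (λ i → f i * c) ≡ ∑ n f * c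
∑-*ʳ zero    c f = sym (*-zeroˡ c)
∑-*ʳ (suc n) c f = trans (cong (_+ f n * c) (∑-*ʳ n c f)) (sym (*-distribʳ-+ c (∑ n f) (f n)))

∑-nonneg : ∀ n {f : ℕ → ℚ} → (∀ i → 0ℚ ≤ f i) → 0ℚ ≤ ∑ n f
∑-nonneg zero    h = ≤-refl
∑-nonneg (suc n) h = +-mono-≤ (∑-nonneg n h) (h n)

indicator : Dec P → ℚ
indicator (yes _) = 1ℚ
indicator (no _)  = 0ℚ

indicator-yes : (d : Dec P) → P → indicator d ≡ 1ℚ
indicator-yes (yes _) p = refl
indicator-yes (no ¬p) p = contradiction p ¬p

indicator-no : (d : Dec P) → ¬ P → indicator d ≡ 0ℚ
indicator-no (yes p) ¬p = contradiction p ¬p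
indicator-no (no _)  ¬p = refl

indicator-cong : (d : Dec P) (e : Dec Q) → (P → Q) → (Q → P) → indicator d ≡ indicator e
indicator-cong (yes p) e f g = sym (indicator-yes e (f p))
indicator-cong (no ¬p) e f g = sym (indicator-no e (¬p ∘ g))

indicator-nonneg : (d : Dec P) → 0ℚ ≤ indicator d
indicator-nonneg (yes _) = 0≤/ 1 1
indicator-nonneg (no _)  = ≤-refl

δ : Monic → Monic → ℚ
δ a b = indicator (a ≟ b)

∑ᴸ-δ-∉ : ∀ {a} xs (f : Monic → ℚ) → ¬ a ∈ xs → ∑ᴸ xs (λ x → δ a x * f x) ≡ 0ℚ
∑ᴸ-δ-∉ {a} xs f a∉xs = trans
  (∑ᴸ-cong-∈ xs λ {x} x∈xs →
    trans (cong (_* f x) (indicator-no (a ≟ x) λ { refl → a∉xs x∈xs })) (*-zeroˡ (f x)))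
  (∑ᴸ-zero xs)

∑ᴸ-δ : ∀ {a} xs (f : Monic → ℚ) → Unique xs → a ∈ xs → ∑ᴸ xs (λ x → δ a x * f x) ≡ f a
∑ᴸ-δ {a} (x ∷ xs) f (x∉xs ∷ _) (here refl) = trans
  (cong₂ _+_ (trans (cong (_* f a) (indicator-yes (a ≟ a) refl)) (*-identityˡ (f a)))
             (∑ᴸ-δ-∉ xs f λ a∈xs → All.lookup x∉xs a∈xs refl))
  (+-identityʳ (f a))
∑ᴸ-δ {a} (x ∷ xs) f (x∉xs ∷ u) (there a∈xs) = trans
  (cong₂ _+_ (trans (cong (_* f x) (indicator-no (a ≟ x) λ { refl → All.lookup x∉xs a∈xs refl }))
                    (*-zeroˡ (f x)))
             (∑ᴸ-δ xs f u a∈xs))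
  (+-identityˡ (f a))

-- Enumerating monic polynomials

vecs : ∀ n → List (Vec Bool n)
vecs zero    = [] ∷ []
vecs (suc n) = map (true ∷_) (vecs n) ++ map (false ∷_) (vecs n)

∈-vecs : ∀ {n} (v : Vec Bool n) → v ∈ vecs n
∈-vecs []          = here refl
∈-vecs (true  ∷ v) = ∈-++⁺ˡ (∈-map⁺ (true ∷_) (∈-vecs v))
∈-vecs (false ∷ v) = ∈-++⁺ʳ _ (∈-map⁺ (false ∷_) (∈-vecs v))

vecs-unique : ∀ n → Unique (vecs n)
vecs-unique zero    = [] ∷ []
vecs-unique (suc n) = Uniqueₚ.++⁺
  (Uniqueₚ.map⁺ (λ { refl → refl }) (vecs-unique n))
  (Uniqueₚ.map⁺ (λ { refl → refl }) (vecs-unique n))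
  λ (h , k) → disjoint (∈-map⁻ (true ∷_) h) (∈-map⁻ (false ∷_) k)
  where
  disjoint : ∀ {v} → ∃[ u ] (u ∈ vecs n × v ≡ true ∷ u) → ∃[ u ] (u ∈ vecs n × v ≡ false ∷ u) → ⊥
  disjoint (_ , _ , refl) (_ , _ , ())

ofDegree : ℕ → List Monic
ofDegree n = map (monic n) (vecs n)

∈-ofDegree : ∀ a → a ∈ ofDegree (deg a)
∈-ofDegree (monic n v) = ∈-map⁺ (monic n) (∈-vecs v)

∈-ofDegree⁻ : ∀ {a n} → a ∈ ofDegree n → deg a ≡ n
∈-ofDegree⁻ {a} {n} h with _ , _ , refl ← ∈-map⁻ (monic n) h = refl

ofDegree-unique : ∀ n → Unique (ofDegree n)
ofDegree-unique n = Uniqueₚ.map⁺ (λ { refl → refl }) (vecs-unique n)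

below : ℕ → List Monic
below zero    = []
below (suc n) = below n ++ ofDegree n

∈-below⁺ : ∀ {a n} → deg a ℕ.< n → a ∈ below n
∈-below⁺ {a} {suc n} (s≤s a≤n) with ℕₚ.m≤n⇒m<n∨m≡n a≤n
... | inj₁ a<n  = ∈-++⁺ˡ (∈-below⁺ a<n)
... | inj₂ refl = ∈-++⁺ʳ (below n) (∈-ofDegree a)

∈-below⁻ : ∀ {a} n → a ∈ below n → deg a ℕ.< n
∈-below⁻ zero    ()
∈-below⁻ (suc n) h with ∈-++⁻ (below n) h
... | inj₁ h′ = ℕₚ.m<n⇒m<1+n (∈-below⁻ n h′)
... | inj₂ h′ = s≤s (ℕₚ.≤-reflexive (∈-ofDegree⁻ h′))

below-unique : ∀ n → Unique (below n)
below-unique zero    = []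
below-unique (suc n) = Uniqueₚ.++⁺ (below-unique n) (ofDegree-unique n)
  λ (h , k) → ℕₚ.<⇒≢ (∈-below⁻ n h) (∈-ofDegree⁻ k)

∑ᴸ-below : ∀ n (f : Monic → ℚ) → ∑ᴸ (below n) f ≡ ∑[ k < n ] (∑ᴸ (ofDegree k) f)
∑ᴸ-below zero    f = refl
∑ᴸ-below (suc n) f = trans (∑ᴸ-++ (below n) (ofDegree n) f)
  (cong (_+ ∑ᴸ (ofDegree n) f) (∑ᴸ-below n f))

-- Vanishing beyond the cutoff replaces membership, so the sum can be sifted at powers and products
-- whose degree may exceed the range.
∑ᴸ-below-δ : ∀ {a} n (f : Monic → ℚ) → (n ℕ.≤ deg a → f a ≡ 0ℚ) →
             ∑ᴸ (below n) (λ x → δ a x * f x) ≡ f a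
∑ᴸ-below-δ {a} n f h with deg a ℕₚ.<? n
... | yes a<n = ∑ᴸ-δ (below n) f (below-unique n) (∈-below⁺ a<n)
... | no  a≮n = trans (∑ᴸ-δ-∉ (below n) f (a≮n ∘ ∈-below⁻ n)) (sym (h (ℕₚ.≮⇒≥ a≮n)))

halfPow : ℕ → ℚ
halfPow zero    = 1ℚ
halfPow (suc n) = ½ * halfPow n

halfPow-+ : ∀ m n → halfPow (m ℕ.+ n) ≡ halfPow m * halfPow n
halfPow-+ zero    n = sym (*-identityˡ _)
halfPow-+ (suc m) n = trans (cong (½ *_) (halfPow-+ m n)) (sym (*-assoc ½ (halfPow m) (halfPow n)))

halfPow-nonneg : ∀ n → 0ℚ ≤ halfPow n
halfPow-nonneg zero    = 0≤/ 1 1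
halfPow-nonneg (suc n) = *-nonneg (0≤/ 1 2) (halfPow-nonneg n)

-- There are 2ⁿ monic polynomials of degree `n`, so `halfPow n` turns a sum over `ofDegree n` into
-- an average.
halfPow-∑ᴸ-const : ∀ n c → halfPow n * ∑ᴸ (ofDegree n) (λ _ → c) ≡ c
halfPow-∑ᴸ-const n c = trans (cong (halfPow n *_) (∑ᴸ-map (monic n) (vecs n) _)) (go n)
  where
  go : ∀ n → halfPow n * ∑ᴸ (vecs n) (λ _ → c) ≡ c
  go zero    = trans (*-identityˡ _) (+-identityʳ c)
  go (suc n) = begin
    ½ * halfPow n * ∑ᴸ (vecs (suc n)) (λ _ → c)
      ≡⟨ cong (½ * halfPow n *_) (trans (∑ᴸ-++ (map (true ∷_) (vecs n)) _ _)
           (cong₂ _+_ (∑ᴸ-map (true ∷_) (vecs n) _) (∑ᴸ-map (false ∷_) (vecs n) _))) ⟩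
    ½ * halfPow n * (s + s)
      ≡⟨ solve 3 (λ a b s → a :* b :* (s :+ s) := a :* (b :* s) :+ a :* (b :* s)) refl
           ½ (halfPow n) s ⟩
    ½ * (halfPow n * s) + ½ * (halfPow n * s)
      ≡⟨ ½+½ _ ⟩
    halfPow n * s
      ≡⟨ go n ⟩
    c ∎
    where
    open ≡-Reasoning
    s = ∑ᴸ (vecs n) (λ _ → c)

-- Irreducible polynomials

infix 4 _∣?_
_∣?_ : ∀ a b → Dec (a ∣ b)
a ∣? b with any? (λ c → b ≟ c · a) (below (suc (deg b)))
... | yes h with c , _ , e ← find h = yes (subst (a ∣_) (sym e) (∣-· c a))
... | no ¬h = no λ a∣b → absurd (∣⇒≡· {a} {b} a∣b)
  where
  absurd : ¬ (∃[ c ] b ≡ c · a)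
  absurd (c , e) = ¬h (lose (∈-below⁺ {c} (s≤s
    (subst (deg c ℕ.≤_) (sym (cong deg e)) (ℕₚ.m≤m+n (deg c) (deg a))))) e)

ProperDivisor : Monic → Monic → Set
ProperDivisor f d = d ∣ f × d ≢ 𝟙 × d ≢ f

irreducible-or-factor : ∀ f → f ≢ 𝟙 → Irreducible f ⊎ ∃[ d ] ProperDivisor f d
irreducible-or-factor f f≢𝟙
  with any? (λ d → (d ∣? f) ×-dec (¬? (d ≟ 𝟙) ×-dec ¬? (d ≟ f))) (below (suc (deg f)))
... | yes h = let d , _ , k = find h in inj₂ (d , k)
... | no ¬h = inj₁ (f≢𝟙 , λ {d} d∣f → trivial d d∣f)
  where
  trivial : ∀ d → d ∣ f → d ≡ 𝟙 ⊎ d ≡ f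
  trivial d d∣f with d ≟ 𝟙 | d ≟ f
  ... | yes d≡𝟙 | _       = inj₁ d≡𝟙
  ... | no  _   | yes d≡f = inj₂ d≡f
  ... | no d≢𝟙  | no d≢f  =
    contradiction (lose (∈-below⁺ (s≤s (∣⇒deg≤ {d} {f} d∣f))) (d∣f , d≢𝟙 , d≢f)) ¬h

irreducible? : ∀ f → Dec (Irreducible f)
irreducible? f with f ≟ 𝟙
... | yes f≡𝟙 = no λ h → proj₁ h f≡𝟙
... | no  f≢𝟙 with irreducible-or-factor f f≢𝟙
...   | inj₁ h                     = yes h
...   | inj₂ (d , d∣f , d≢𝟙 , d≢f) = no λ h → go (proj₂ h {d} d∣f)
  where
  go : ¬ (d ≡ 𝟙 ⊎ d ≡ f)
  go (inj₁ e) = d≢𝟙 e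
  go (inj₂ e) = d≢f e

·-identityˡ : ∀ a → 𝟙 · a ≡ a
·-identityˡ a = trans (·-comm 𝟙 a) (·-identityʳ a)

proper⇒deg< : ∀ {f d} → d ∣ f → d ≢ f → deg d ℕ.< deg f
proper⇒deg< {f} {d} d∣f d≢f with ∣⇒≡· {d} {f} d∣f
... | monic zero [] , e = contradiction (sym (trans e (·-identityˡ d))) d≢f
... | c@(monic (suc _) _) , e = subst (deg d ℕ.<_) (sym (cong deg e)) (s≤s (ℕₚ.m≤n+m (deg d) _))

irreducible-factor : ∀ f → f ≢ 𝟙 → ∃[ p ] (Irreducible p × p ∣ f)
irreducible-factor f = go f (<-wellFounded (deg f))
  where
  go : ∀ f → Acc ℕ._<_ (deg f) → f ≢ 𝟙 → ∃[ p ] (Irreducible p × p ∣ f)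
  go f (acc rec) f≢𝟙 with irreducible-or-factor f f≢𝟙
  ... | inj₁ h = f , h , ∣-refl f
  ... | inj₂ (d , d∣f , d≢𝟙 , d≢f) =
    let p , h , p∣d = go d (rec (proper⇒deg< {f} {d} d∣f d≢f)) d≢𝟙
    in p , h , ∣-trans {p} {d} {f} p∣d d∣f

irreducible⇒deg>0 : ∀ {p} → Irreducible p → 0 ℕ.< deg p
irreducible⇒deg>0 {monic zero []}    (p≢𝟙 , _) = contradiction refl p≢𝟙
irreducible⇒deg>0 {monic (suc n) v} _          = s≤s z≤n

-- Powers of irreducibles and counting multiples

infixr 8 _^_
_^_ : Monic → ℕ → Monic
p ^ zero  = 𝟙
p ^ suc j = p · (p ^ j)

n≤deg-^ : ∀ {p} → 0 ℕ.< deg p → ∀ n → n ℕ.≤ deg (p ^ n)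
n≤deg-^ h zero    = z≤n
n≤deg-^ h (suc n) = ℕₚ.+-mono-≤ h (n≤deg-^ h n)

𝟙∣ : ∀ a → 𝟙 ∣ a
𝟙∣ a = subst (𝟙 ∣_) (·-identityʳ a) (∣-· a 𝟙)

·-monoˡ-∣ : ∀ {a b} c → a ∣ b → c · a ∣ b · c
·-monoˡ-∣ {a} {b} c a∣b with e , refl ← ∣⇒≡· {a} {b} a∣b = subst (c · a ∣_)
  (trans (cong (e ·_) (·-comm c a)) (sym (·-assoc e a c))) (∣-· e (c · a))

·-cancel-∣ : ∀ {a b} c → c · a ∣ b · c → a ∣ b
·-cancel-∣ {a} {b} c h with e , k ← ∣⇒≡· {c · a} {b · c} h =
  subst (a ∣_) (sym b≡e·a) (∣-· e a)
  where
  b≡e·a : b ≡ e · a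
  b≡e·a = ·-cancelʳ c (trans k (trans (cong (e ·_) (·-comm c a)) (sym (·-assoc e a c))))

-- By Euclid's lemma the first factor `p` divides `g`, since it cannot divide the other irreducible
-- `r`; cancelling it from both sides lowers the exponent.
^∣-cancel : ∀ {p r} → Irreducible p → Irreducible r → p ≢ r → ∀ j {g} → p ^ j ∣ g · r → p ^ j ∣ g
^∣-cancel         hp hr p≢r zero    {g} h = 𝟙∣ g
^∣-cancel {p} {r} hp hr p≢r (suc j) {g} h
  with euclid {p} {g} {r} hp (∣-trans {p} {p ^ suc j} {g · r} (∣-·ˡ (p ^ j) p) h)
... | inj₂ p∣r with proj₂ hr {p} p∣r
...   | inj₁ p≡𝟙 = contradiction p≡𝟙 (proj₁ hp)
...   | inj₂ p≡r = contradiction p≡r p≢r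
^∣-cancel {p} {r} hp hr p≢r (suc j) {g} h | inj₁ p∣g with g′ , refl ← ∣⇒≡· {p} {g} p∣g =
  ·-monoˡ-∣ {p ^ j} {g′} p (^∣-cancel hp hr p≢r j {g′}
    (·-cancel-∣ {p ^ j} {g′ · r} p (subst (p ^ suc j ∣_) swap h)))
  where
  swap : (g′ · p) · r ≡ (g′ · r) · p
  swap = trans (·-assoc g′ p r) (trans (cong (g′ ·_) (·-comm p r)) (sym (·-assoc g′ r p)))

-- Cancellation makes the cofactor of `q` in `f` unique, so the sum counts it once or not at all.
-- Divisibility becomes a sum that can be interchanged with others.
indicator-∣ : ∀ {xs} → Unique xs → ∀ q f → (∀ c → f ≡ c · q → c ∈ xs) →
              ∑ᴸ xs (λ g → δ (g · q) f) ≡ indicator (q ∣? f)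
indicator-∣ {xs} u q f h with q ∣? f
... | no q∤f = trans
  (∑ᴸ-cong xs λ g → indicator-no (g · q ≟ f) λ { refl → q∤f (∣-· g q) }) (∑ᴸ-zero xs)
... | yes q∣f with c , refl ← ∣⇒≡· {q} {f} q∣f = trans
  (∑ᴸ-cong xs λ g → trans (indicator-cong (g · q ≟ c · q) (c ≟ g)
    (λ e → sym (·-cancelʳ q e)) (λ e → cong (_· q) (sym e))) (sym (*-identityʳ _)))
  (∑ᴸ-δ xs (λ _ → 1ℚ) u (h c refl))

-- The multiples of `q` of degree `n` are the `g · q` with deg g = n - deg q, a proportion 2^(-deg
-- q) of all.
multiples : ∀ q n → deg q ℕ.≤ n →
            halfPow n * ∑ᴸ (ofDegree n) (λ f → indicator (q ∣? f)) ≡ halfPow (deg q)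
multiples q n q≤n = begin
  halfPow n * ∑ᴸ (ofDegree n) (λ f → indicator (q ∣? f))
    ≡⟨ cong (halfPow n *_) (∑ᴸ-cong-∈ (ofDegree n) λ {f} f∈ → sym
         (indicator-∣ (ofDegree-unique m) q f λ { c refl → subst (λ k → c ∈ ofDegree k)
           (trans (sym (ℕₚ.m+n∸n≡m (deg c) (deg q))) (cong (ℕ._∸ deg q) (∈-ofDegree⁻ f∈)))
           (∈-ofDegree c) })) ⟩
  halfPow n * ∑ᴸ (ofDegree n) (λ f → ∑ᴸ (ofDegree m) λ g → δ (g · q) f)
    ≡⟨ cong (halfPow n *_) (trans (∑ᴸ-swap (ofDegree n) (ofDegree m) _)
         (∑ᴸ-cong-∈ (ofDegree m) λ {g} g∈ → trans
           (∑ᴸ-cong (ofDegree n) λ f → sym (*-identityʳ _))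
           (∑ᴸ-δ (ofDegree n) (λ _ → 1ℚ) (ofDegree-unique n)
             (subst (λ k → g · q ∈ ofDegree k)
               (trans (cong (ℕ._+ deg q) (∈-ofDegree⁻ g∈)) (ℕₚ.m∸n+n≡m q≤n))
               (∈-ofDegree (g · q)))))) ⟩
  halfPow n * s
    ≡⟨ cong (_* s) (trans (cong halfPow (sym (ℕₚ.m∸n+n≡m q≤n))) (halfPow-+ m (deg q))) ⟩
  halfPow m * halfPow (deg q) * s
    ≡⟨ solve 3 (λ a b c → a :* b :* c := a :* c :* b) refl (halfPow m) (halfPow (deg q)) s ⟩
  halfPow m * s * halfPow (deg q)
    ≡⟨ cong (_* halfPow (deg q)) (halfPow-∑ᴸ-const m 1ℚ) ⟩
  1ℚ * halfPow (deg q)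
    ≡⟨ *-identityˡ _ ⟩
  halfPow (deg q) ∎
  where
  open ≡-Reasoning
  m = n ℕ.∸ deg q
  s = ∑ᴸ (ofDegree m) (λ _ → 1ℚ)

-- The von Mangoldt function

fromℕ-+ : ∀ m n → fromℕ (m ℕ.+ n) ≡ fromℕ m + fromℕ n
fromℕ-+ zero    n = sym (+-identityˡ _)
fromℕ-+ (suc m) n = begin
  fromℕ (suc (m ℕ.+ n))    ≡⟨ fromℕ-suc (m ℕ.+ n) ⟩
  fromℕ (m ℕ.+ n) + 1ℚ     ≡⟨ cong (_+ 1ℚ) (fromℕ-+ m n) ⟩
  fromℕ m + fromℕ n + 1ℚ   ≡⟨ solve 3 (λ a b c → a :+ b :+ c := a :+ c :+ b) refl
                                (fromℕ m) (fromℕ n) 1ℚ ⟩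
  fromℕ m + 1ℚ + fromℕ n   ≡⟨ cong (_+ fromℕ n) (fromℕ-suc m) ⟨
  fromℕ (suc m) + fromℕ n  ∎
  where open ≡-Reasoning

module Mangoldt (N : ℕ) where

  primes : List Monic
  primes = filter irreducible? (below (suc N))

  ∈-primes⁻ : ∀ {p} → p ∈ primes → Irreducible p
  ∈-primes⁻ h = proj₂ (∈-filter⁻ irreducible? {xs = below (suc N)} h)

  -- The exponent of p in f, truncated at N.
  valuation : Monic → Monic → ℚ
  valuation p f = ∑[ j < N ] indicator (p ^ suc j ∣? f)

  valuation-𝟙 : ∀ {p} → Irreducible p → valuation p 𝟙 ≡ 0ℚ
  valuation-𝟙 {p} hp = trans (∑-cong N λ j → indicator-no (p ^ suc j ∣? 𝟙) λ h →
    contradiction (ℕₚ.≤-trans (n≤deg-^ (irreducible⇒deg>0 hp) (suc j))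
                              (∣⇒deg≤ {p ^ suc j} {𝟙} h)) λ ())
    (trans (∑-const N 0ℚ) (*-zeroʳ (fromℕ N)))

  -- The bound on `deg g` keeps the truncation of the exponent at `N` from being felt.
  valuation-· : ∀ {p r} g → Irreducible p → Irreducible r → deg g ℕ.< N →
                valuation p (g · r) ≡ valuation p g + δ r p
  valuation-· {p} {r} g hp hr g<N with r ≟ p
  ... | no r≢p = trans
    (∑-cong N λ j → indicator-cong (p ^ suc j ∣? g · r) (p ^ suc j ∣? g)
      (^∣-cancel hp hr (r≢p ∘ sym) (suc j) {g})
      (λ h → ∣-trans {p ^ suc j} {g} {g · r} h (∣-·ˡ r g)))
    (sym (+-identityʳ _))
  ... | yes refl = begin
    valuation p (g · p)
      ≡⟨ ∑-cong N (λ j → indicator-cong (p ^ suc j ∣? g · p) (p ^ j ∣? g)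
           (·-cancel-∣ {p ^ j} {g} p) (·-monoˡ-∣ {p ^ j} {g} p)) ⟩
    ∑ N v
      ≡⟨ +-identityʳ _ ⟨
    ∑ N v + 0ℚ
      -- The exponents 0 to N - 1 are extended by `N`, which adds nothing because `p ^ N` has degree
      -- at least `N`. Splitting off exponent 0 then leaves the valuation of `g` and an extra 1.
      ≡⟨ cong (∑ N v +_) (indicator-no (p ^ N ∣? g) λ h → ℕₚ.<⇒≱ g<N
           (ℕₚ.≤-trans (n≤deg-^ (irreducible⇒deg>0 hp) N) (∣⇒deg≤ {p ^ N} {g} h))) ⟨
    ∑ (suc N) v
      ≡⟨ ∑-split v 1 N ⟩
    0ℚ + v 0 + valuation p g
      ≡⟨ cong (λ z → 0ℚ + z + valuation p g) (indicator-yes (𝟙 ∣? g) (𝟙∣ g)) ⟩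
    0ℚ + 1ℚ + valuation p g
      ≡⟨ +-comm 1ℚ (valuation p g) ⟩
    valuation p g + 1ℚ ∎
    where
    open ≡-Reasoning
    v : ℕ → ℚ
    v j = indicator (p ^ j ∣? g)

  -- Unique factorization measured by degree: removing an irreducible factor `r` lowers only the
  -- valuation at `r`, by 1, and the degree by `deg r`.
  factorization : ∀ f → deg f ℕ.≤ N →
                  ∑ᴸ primes (λ p → valuation p f * fromℕ (deg p)) ≡ fromℕ (deg f)
  factorization f = go f (<-wellFounded (deg f))
    where
    open ≡-Reasoning
    go : ∀ f → Acc ℕ._<_ (deg f) → deg f ℕ.≤ N →
         ∑ᴸ primes (λ p → valuation p f * fromℕ (deg p)) ≡ fromℕ (deg f)
    go f (acc rec) f≤N with f ≟ 𝟙
    ... | yes refl = trans (∑ᴸ-cong-∈ primes λ {p} p∈ →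
      trans (cong (_* fromℕ (deg p)) (valuation-𝟙 (∈-primes⁻ p∈))) (*-zeroˡ (fromℕ (deg p))))
      (∑ᴸ-zero primes)
    ... | no f≢𝟙 with irreducible-factor f f≢𝟙
    ...   | r , hr , r∣f with g , refl ← ∣⇒≡· {r} {f} r∣f = begin
      ∑ᴸ primes (λ p → valuation p (g · r) * fromℕ (deg p))
        ≡⟨ ∑ᴸ-cong-∈ primes (λ {p} p∈ → trans
             (cong (_* fromℕ (deg p)) (valuation-· g (∈-primes⁻ p∈) hr (ℕₚ.<-≤-trans g<f f≤N)))
             (*-distribʳ-+ (fromℕ (deg p)) (valuation p g) (δ r p))) ⟩
      ∑ᴸ primes (λ p → valuation p g * fromℕ (deg p) + δ r p * fromℕ (deg p))
        ≡⟨ ∑ᴸ-+ primes _ _ ⟩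
      ∑ᴸ primes (λ p → valuation p g * fromℕ (deg p)) + ∑ᴸ primes (λ p → δ r p * fromℕ (deg p))
        ≡⟨ cong₂ _+_ (go g (rec g<f) (ℕₚ.<⇒≤ (ℕₚ.<-≤-trans g<f f≤N)))
             (∑ᴸ-δ primes (λ p → fromℕ (deg p))
               (Uniqueₚ.filter⁺ irreducible? (below-unique (suc N)))
               (∈-filter⁺ irreducible?
                 (∈-below⁺ (s≤s (ℕₚ.≤-trans (ℕₚ.m≤n+m (deg r) (deg g)) f≤N))) hr)) ⟩
      fromℕ (deg g) + fromℕ (deg r)
        ≡⟨ fromℕ-+ (deg g) (deg r) ⟨
      fromℕ (deg g ℕ.+ deg r) ∎
      where
      g<f : deg g ℕ.< deg g ℕ.+ deg r
      g<f = subst (ℕ._≤ deg g ℕ.+ deg r) (ℕₚ.+-comm (deg g) 1)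
              (ℕₚ.+-monoʳ-≤ (deg g) (irreducible⇒deg>0 hr))

  -- Truncated: Λ vanishes on p^j unless deg p ≤ N and j ≤ N.
  Λ : Monic → ℚ
  Λ q = ∑ᴸ primes λ p → (∑[ j < N ] δ (p ^ suc j) q) * fromℕ (deg p)

  Λ-nonneg : ∀ q → 0ℚ ≤ Λ q
  Λ-nonneg q = ∑ᴸ-nonneg primes λ p →
    *-nonneg (∑-nonneg N λ j → indicator-nonneg (p ^ suc j ≟ q)) (0≤/ (deg p) 1)

  Λ-𝟙 : ∀ {q} → deg q ≡ 0 → Λ q ≡ 0ℚ
  Λ-𝟙 {q} q≡0 = trans (∑ᴸ-cong-∈ primes λ {p} p∈ → trans
    (cong (_* fromℕ (deg p)) (trans (∑-cong N λ j → indicator-no (p ^ suc j ≟ q)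
        λ { refl → contradiction
          (subst (suc j ℕ.≤_) q≡0 (n≤deg-^ (irreducible⇒deg>0 (∈-primes⁻ p∈)) (suc j))) λ () })
      (trans (∑-const N 0ℚ) (*-zeroʳ (fromℕ N)))))
    (*-zeroˡ (fromℕ (deg p)))) (∑ᴸ-zero primes)

  -- The analogue of Σ_{d ∣ n} Λ(d) = log n: summing over `q` first leaves valuations times degrees.
  -- The range `M` is separate from the truncation `N` because `∑-density` sums over lower degrees
  -- only.
  ∑Λ : ∀ M f → deg f ℕ.< M → deg f ℕ.≤ N →
       ∑ᴸ (below M) (λ q → Λ q * indicator (q ∣? f)) ≡ fromℕ (deg f)
  ∑Λ M f f<M f≤N = begin
    ∑ᴸ (below M) (λ q → Λ q * indicator (q ∣? f))
      ≡⟨ ∑ᴸ-cong (below M) (λ q → sym (∑ᴸ-*ʳ primes (indicator (q ∣? f)) _)) ⟩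
    ∑ᴸ (below M) (λ q → ∑ᴸ primes λ p →
      (∑[ j < N ] δ (p ^ suc j) q) * fromℕ (deg p) * indicator (q ∣? f))
      ≡⟨ ∑ᴸ-swap (below M) primes _ ⟩
    ∑ᴸ primes (λ p → ∑ᴸ (below M) λ q →
      (∑[ j < N ] δ (p ^ suc j) q) * fromℕ (deg p) * indicator (q ∣? f))
      ≡⟨ ∑ᴸ-cong primes inner ⟩
    ∑ᴸ primes (λ p → valuation p f * fromℕ (deg p))
      ≡⟨ factorization f f≤N ⟩
    fromℕ (deg f) ∎
    where
    open ≡-Reasoning
    inner : ∀ p →
      ∑ᴸ (below M) (λ q → (∑[ j < N ] δ (p ^ suc j) q) * fromℕ (deg p) * indicator (q ∣? f)) ≡
      valuation p f * fromℕ (deg p)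
    inner p = begin
      ∑ᴸ (below M) (λ q → (∑[ j < N ] δ (p ^ suc j) q) * fromℕ (deg p) * indicator (q ∣? f))
        ≡⟨ ∑ᴸ-cong (below M) (λ q → trans
             (solve 3 (λ a b c → a :* b :* c := a :* c :* b) refl
               (∑[ j < N ] δ (p ^ suc j) q) (fromℕ (deg p)) (indicator (q ∣? f)))
             (cong (_* fromℕ (deg p)) (sym (∑-*ʳ N (indicator (q ∣? f)) _)))) ⟩
      ∑ᴸ (below M) (λ q → (∑[ j < N ] (δ (p ^ suc j) q * indicator (q ∣? f))) * fromℕ (deg p))
        ≡⟨ ∑ᴸ-*ʳ (below M) (fromℕ (deg p)) _ ⟩
      ∑ᴸ (below M) (λ q → ∑[ j < N ] (δ (p ^ suc j) q * indicator (q ∣? f))) * fromℕ (deg p)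
        ≡⟨ cong (_* fromℕ (deg p)) (trans (∑ᴸ-∑-swap (below M) N _)
             (∑-cong N λ j → ∑ᴸ-below-δ M (λ q → indicator (q ∣? f)) λ M≤ →
               indicator-no (p ^ suc j ∣? f) λ h →
                 ℕₚ.<⇒≱ (ℕₚ.<-≤-trans f<M M≤) (∣⇒deg≤ {p ^ suc j} {f} h))) ⟩
      valuation p f * fromℕ (deg p) ∎

  density : ℕ → ℚ
  density k = halfPow k * ∑ᴸ (ofDegree k) Λ

  ∑ᴸ-by-degree : ∀ M (φ : ℕ → ℚ) →
    ∑ᴸ (below M) (λ q → Λ q * (halfPow (deg q) * φ (deg q))) ≡ ∑[ k < M ] (density k * φ k)
  ∑ᴸ-by-degree M φ = trans (∑ᴸ-below M _) (∑-cong M λ k → trans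
    (∑ᴸ-cong-∈ (ofDegree k) λ {q} q∈ → cong (λ d → Λ q * (halfPow d * φ d)) (∈-ofDegree⁻ q∈))
    (trans (∑ᴸ-*ʳ (ofDegree k) (halfPow k * φ k) Λ)
      (solve 3 (λ a b c → a :* (b :* c) := b :* a :* c) refl
        (∑ᴸ (ofDegree k) Λ) (halfPow k) (φ k))))

  -- Double counting: the average of deg f over degree `n` is `n`, and by `∑Λ` and `multiples` it is
  -- also the sum of Λ(q) 2^(-deg q) over all `q` of degree at most `n`.
  ∑-density : ∀ n → n ℕ.≤ N → ∑ (suc n) density ≡ fromℕ n
  ∑-density n n≤N = begin
    ∑ (suc n) density
      ≡⟨ ∑-cong (suc n) (λ k → sym (*-identityʳ _)) ⟩
    ∑[ k < suc n ] (density k * 1ℚ)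
      ≡⟨ ∑ᴸ-by-degree (suc n) (λ _ → 1ℚ) ⟨
    ∑ᴸ (below (suc n)) (λ q → Λ q * (halfPow (deg q) * 1ℚ))
      ≡⟨ ∑ᴸ-cong-∈ (below (suc n)) (λ {q} q∈ → cong (Λ q *_) (trans (*-identityʳ _)
           (sym (multiples q n (ℕₚ.≤-pred (∈-below⁻ (suc n) q∈)))))) ⟩
    ∑ᴸ (below (suc n)) (λ q → Λ q * (halfPow n * ∑ᴸ (ofDegree n) (λ f → indicator (q ∣? f))))
      ≡⟨ ∑ᴸ-cong (below (suc n)) (λ q → trans
           (solve 3 (λ a b c → a :* (b :* c) := b :* (a :* c)) refl (Λ q) (halfPow n) _)
           (cong (halfPow n *_) (sym (∑ᴸ-*ˡ (ofDegree n) (Λ q) _)))) ⟩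
    ∑ᴸ (below (suc n)) (λ q → halfPow n * ∑ᴸ (ofDegree n) (λ f → Λ q * indicator (q ∣? f)))
      ≡⟨ trans (∑ᴸ-*ˡ (below (suc n)) (halfPow n) _)
           (cong (halfPow n *_) (∑ᴸ-swap (below (suc n)) (ofDegree n) _)) ⟩
    halfPow n * ∑ᴸ (ofDegree n) (λ f → ∑ᴸ (below (suc n)) λ q → Λ q * indicator (q ∣? f))
      ≡⟨ cong (halfPow n *_) (∑ᴸ-cong-∈ (ofDegree n) λ {f} f∈ → trans
           (∑Λ (suc n) f (s≤s (ℕₚ.≤-reflexive (∈-ofDegree⁻ f∈)))
             (subst (ℕ._≤ N) (sym (∈-ofDegree⁻ f∈)) n≤N))
           (cong fromℕ (∈-ofDegree⁻ f∈))) ⟩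
    halfPow n * ∑ᴸ (ofDegree n) (λ _ → fromℕ n)
      ≡⟨ halfPow-∑ᴸ-const n (fromℕ n) ⟩
    fromℕ n ∎
    where open ≡-Reasoning

  density-zero : density 0 ≡ 0ℚ
  density-zero = trans (sym (+-identityˡ _)) (∑-density 0 z≤n)

  -- The exact prime number theorem for 𝔽₂[x], read off as a difference of consecutive sums.
  density-suc : ∀ k → k ℕ.< N → density (suc k) ≡ 1ℚ
  density-suc k k<N = begin
    density (suc k)
      ≡⟨ solve 2 (λ s d → d := s :+ d :- s) refl (∑ (suc k) density) (density (suc k)) ⟩
    ∑ (suc (suc k)) density - ∑ (suc k) density
      ≡⟨ cong₂ _-_ (trans (∑-density (suc k) k<N) (fromℕ-suc k)) (∑-density k (ℕₚ.<⇒≤ k<N)) ⟩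
    fromℕ k + 1ℚ - fromℕ k
      ≡⟨ solve 2 (λ a b → a :+ b :- a := b) refl (fromℕ k) 1ℚ ⟩
    1ℚ ∎
    where open ≡-Reasoning

-- The flow

zero-or-positive : ∀ n → n ≡ 0 ⊎ 0 ℕ.< n
zero-or-positive zero    = inj₁ refl
zero-or-positive (suc n) = inj₂ (s≤s z≤n)

-- The junk value 0 at n = 0 lets sums run over all degrees.
inv : ℕ → ℚ
inv zero    = 0ℚ
inv (suc n) = recip (suc n)

inv-nonneg : ∀ n → 0ℚ ≤ inv n
inv-nonneg zero    = ≤-refl
inv-nonneg (suc n) = 0≤/ 1 (suc n)

inv-* : ∀ n → inv (suc n) * fromℕ (suc n) ≡ 1ℚ
inv-* n = trans (/-* 1 (suc n) (suc n) 1) (/-≡ (1 ℕ.* suc n) (suc n ℕ.* 1) 1 1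
  (trans (ℕₚ.*-identityʳ (1 ℕ.* suc n)) (cong (1 ℕ.*_) (sym (ℕₚ.*-identityʳ (suc n))))))

inv-telescope : ∀ m → inv (1 ℕ.+ m) ≡ inv (1 ℕ.+ m) * inv (2 ℕ.+ m) + inv (2 ℕ.+ m)
inv-telescope m = begin
  x                       ≡⟨ *-identityʳ x ⟨
  x * 1ℚ                  ≡⟨ cong (x *_) (inv-* (suc m)) ⟨
  x * (y * fromℕ (2 ℕ.+ m))
    ≡⟨ cong (λ z → x * (y * z)) (fromℕ-suc (suc m)) ⟩
  x * (y * (n + 1ℚ))
    ≡⟨ solve 3 (λ x y n → x :* (y :* (n :+ con 1ℚ)) := x :* y :+ y :* (x :* n)) refl x y n ⟩
  x * y + y * (x * n)
    ≡⟨ cong (λ z → x * y + z) (trans (cong (y *_) (inv-* m)) (*-identityʳ y)) ⟩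
  x * y + y ∎
  where
  open ≡-Reasoning
  x = inv (1 ℕ.+ m)
  y = inv (2 ℕ.+ m)
  n = fromℕ (suc m)

inv²-step : ∀ m → inv (2 ℕ.+ m) * inv (2 ℕ.+ m) + inv (2 ℕ.+ m) ≤ inv (1 ℕ.+ m)
inv²-step m = ≤-trans
  (+-monoˡ-≤ (inv (2 ℕ.+ m)) (*-monoʳ (inv-nonneg (2 ℕ.+ m))
    (recip-mono (1 ℕ.+ m) (2 ℕ.+ m) (ℕₚ.n≤1+n (1 ℕ.+ m)))))
  (≤-reflexive (sym (inv-telescope m)))

-- Telescoping with 1/m² ≤ 1/(m-1) - 1/m; the remainder is kept on the left so that the induction
-- closes.
∑-inv² : ∀ n N →
  ∑[ k < N ] (inv (suc n ℕ.+ suc k) * inv (suc n ℕ.+ suc k)) + inv (suc n ℕ.+ N) ≤ inv (suc n)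
∑-inv² n zero    = ≤-reflexive (trans (+-identityˡ _) (cong inv (ℕₚ.+-identityʳ (suc n))))
∑-inv² n (suc N) = begin
  S + z * z + z
    ≡⟨ +-assoc S _ _ ⟩
  S + (z * z + z)
    ≤⟨ +-monoʳ-≤ S (subst (λ k → inv k * inv k + inv k ≤ inv (suc n ℕ.+ N))
         (sym (ℕₚ.+-suc (suc n) N)) (inv²-step (n ℕ.+ N))) ⟩
  S + inv (suc n ℕ.+ N)
    ≤⟨ ∑-inv² n N ⟩
  inv (suc n) ∎
  where
  open ≤-Reasoning
  S = ∑[ k < N ] (inv (suc n ℕ.+ suc k) * inv (suc n ℕ.+ suc k))
  z = inv (suc n ℕ.+ suc N)

∑-inv²≤inv : ∀ n N → ∑[ k < N ] (inv (suc n ℕ.+ suc k) * inv (suc n ℕ.+ suc k)) ≤ inv (suc n)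
∑-inv²≤inv n N = ≤-trans (subst (_≤ S + inv (suc n ℕ.+ N)) (+-identityʳ S)
  (+-monoʳ-≤ S (inv-nonneg (suc n ℕ.+ N)))) (∑-inv² n N)
  where S = ∑[ k < N ] (inv (suc n ℕ.+ suc k) * inv (suc n ℕ.+ suc k))

-- Three terms are taken exactly and the tail costs 1/3. Stopping after two would give 1 + 1/4 + 1/2
-- = 7/4, above the lower bound 1.6989 for 1 + e^γ/2.
∑-inv²≤61/36 : ∀ N → ∑[ k < N ] (inv (suc k) * inv (suc k)) ≤ ℤ.+ 61 / 36
∑-inv²≤61/36 0 = toWitness {a? = 0ℚ ≤? ℤ.+ 61 / 36} _
∑-inv²≤61/36 1 = toWitness {a? = ∑[ k < 1 ] (inv (suc k) * inv (suc k)) ≤? ℤ.+ 61 / 36} _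
∑-inv²≤61/36 2 = toWitness {a? = ∑[ k < 2 ] (inv (suc k) * inv (suc k)) ≤? ℤ.+ 61 / 36} _
∑-inv²≤61/36 (suc (suc (suc r))) = begin
  ∑ (3 ℕ.+ r) f                         ≡⟨ ∑-split f 3 r ⟩
  ∑ 3 f + ∑[ k < r ] f (3 ℕ.+ k)        ≤⟨ +-monoʳ-≤ (∑ 3 f) (∑-inv²≤inv 2 r) ⟩
  ∑ 3 f + inv 3                         ≤⟨ toWitness {a? = ∑ 3 f + inv 3 ≤? ℤ.+ 61 / 36} _ ⟩
  ℤ.+ 61 / 36                             ∎
  where
  open ≤-Reasoning
  f : ℕ → ℚ
  f k = inv (suc k) * inv (suc k)

-- A total form of `term`, with the value 0 at `𝟙`.
weight : Monic → ℚ
weight a = halfPow (deg a) * inv (deg a)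

weight-nonneg : ∀ a → 0ℚ ≤ weight a
weight-nonneg a = *-nonneg (halfPow-nonneg (deg a)) (inv-nonneg (deg a))

halfPow≡recip : ∀ n → halfPow n ≡ recip (2 ℕ.^ n) {{ℕₚ.m^n≢0 2 n}}
halfPow≡recip zero    = refl
halfPow≡recip (suc n) = trans (cong (½ *_) (halfPow≡recip n))
  (/-* 1 2 1 (2 ℕ.^ n) {{_}} {{ℕₚ.m^n≢0 2 n}} {{ℕₚ.m^n≢0 2 (suc n)}})

term≡weight : ∀ a (nz : PositiveDegree a) → term a nz ≡ weight a
term≡weight (monic (suc k) v) nz = sym (trans (cong (_* inv (suc k)) (halfPow≡recip (suc k)))
  (/-* 1 (2 ℕ.^ suc k) 1 (suc k) {{ℕₚ.m^n≢0 2 (suc k)}} {{_}}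
    {{ℕₚ.m*n≢0 (2 ℕ.^ suc k) (suc k) {{ℕₚ.m^n≢0 2 (suc k)}}}}))

finiteSum≡∑ : ∀ {as} (nzs : All PositiveDegree as) → finiteSum nzs ≡ ∑ᴸ as weight
finiteSum≡∑ []         = refl
finiteSum≡∑ (_∷_ {x = a} nz nzs) = cong₂ _+_ (term≡weight a nz) (finiteSum≡∑ nzs)

open DecMembership _≟_ using (_∈?_)

module Flow (N : ℕ) (S : List Monic) (unique : Unique S)
  (degree : ∀ {a} → a ∈ S → 0 ℕ.< deg a × deg a ℕ.≤ N)
  (antichain : ∀ {a b} → a ∈ S → b ∈ S → a ≢ b → ¬ a ∣ b) where

  open Mangoldt N

  U : List Monic
  U = below (suc N)

  source : Monic → ℚ
  source g = ∑ᴸ S λ a → δ g a * weight a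

  source-∈ : ∀ {g} → g ∈ S → source g ≡ weight g
  source-∈ = ∑ᴸ-δ S weight unique

  source-∉ : ∀ {g} → ¬ g ∈ S → source g ≡ 0ℚ
  source-∉ = ∑ᴸ-δ-∉ S weight

  inflow : (Monic → ℚ) → Monic → ℚ
  inflow m g = ∑ᴸ U λ q → Λ q * (m (g · q) * inv (deg g ℕ.+ deg q))

  -- Mass is emitted at the elements of S and a mass at f moves to f/q with probability
  -- Λ q / deg f; mass t g is what has arrived at g after at most t moves.
  mass : ℕ → Monic → ℚ
  mass zero    g = source g
  mass (suc t) g = source g + inflow (mass t) g

  -- Λ vanishes at `𝟙`, so mass arrives only from strictly larger degree.
  inflow-cong : ∀ m m′ g → (∀ q → 0 ℕ.< deg q → m (g · q) ≡ m′ (g · q)) → inflow m g ≡ inflow m′ g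
  inflow-cong m m′ g h = ∑ᴸ-cong U λ q → same q (zero-or-positive (deg q))
    where
    i : Monic → ℚ
    i q = inv (deg g ℕ.+ deg q)
    same : ∀ q → deg q ≡ 0 ⊎ 0 ℕ.< deg q → Λ q * (m (g · q) * i q) ≡ Λ q * (m′ (g · q) * i q)
    same q (inj₁ q≡0) = trans (cong (_* (m (g · q) * i q)) (Λ-𝟙 q≡0))
      (trans (*-zeroˡ (m (g · q) * i q))
        (sym (trans (cong (_* (m′ (g · q) * i q)) (Λ-𝟙 q≡0)) (*-zeroˡ (m′ (g · q) * i q)))))
    same q (inj₂ q>0) = cong (λ z → Λ q * (z * i q)) (h q q>0)

  inflow-zero : ∀ m g → (∀ q → 0 ℕ.< deg q → m (g · q) ≡ 0ℚ) → inflow m g ≡ 0ℚ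
  inflow-zero m g h = trans (inflow-cong m (λ _ → 0ℚ) g h) (trans
    (∑ᴸ-cong U λ q → trans (cong (Λ q *_) (*-zeroˡ (inv (deg g ℕ.+ deg q)))) (*-zeroʳ (Λ q)))
    (∑ᴸ-zero U))

  mass-nonneg : ∀ t g → 0ℚ ≤ mass t g
  mass-nonneg zero    g = ∑ᴸ-nonneg S λ a → *-nonneg (indicator-nonneg (g ≟ a)) (weight-nonneg a)
  mass-nonneg (suc t) g = +-mono-≤ (mass-nonneg 0 g) (∑ᴸ-nonneg U λ q →
    *-nonneg (Λ-nonneg q) (*-nonneg (mass-nonneg t (g · q)) (inv-nonneg (deg g ℕ.+ deg q))))

  -- Mass starts in `S` and moves only to divisors.
  mass-∤ : ∀ t g → (∀ {a} → a ∈ S → ¬ g ∣ a) → mass t g ≡ 0ℚ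
  mass-∤ zero    g h = source-∉ λ g∈S → h g∈S (∣-refl g)
  mass-∤ (suc t) g h = cong₂ _+_ (mass-∤ 0 g h) (inflow-zero (mass t) g λ q _ →
    mass-∤ t (g · q) λ {a} a∈S gq∣a → h a∈S (∣-trans {g} {g · q} {a} (∣-·ˡ q g) gq∣a))

  mass-beyond : ∀ t g → N ℕ.< deg g → mass t g ≡ 0ℚ
  mass-beyond t g N<g = mass-∤ t g λ {a} a∈S g∣a →
    ℕₚ.<⇒≱ N<g (ℕₚ.≤-trans (∣⇒deg≤ {g} {a} g∣a) (proj₂ (degree a∈S)))

  -- Each move lowers the degree by at least 1 and no mass lies above degree `N`, so all mass bound
  -- for `g` has arrived after N - deg g moves.
  mass-stable : ∀ t g → N ℕ.≤ deg g ℕ.+ t → mass (suc t) g ≡ mass t g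
  mass-stable zero    g h = trans (cong (λ z → source g + z) (inflow-zero (mass 0) g λ q q>0 →
      mass-beyond 0 (g · q) (ℕₚ.≤-<-trans (subst (N ℕ.≤_) (ℕₚ.+-identityʳ (deg g)) h)
        (ℕₚ.m<m+n (deg g) q>0))))
    (+-identityʳ _)
  mass-stable (suc t) g h = cong (λ z → source g + z) (
    inflow-cong (mass (suc t)) (mass t) g λ q q>0 →
    mass-stable t (g · q) (ℕₚ.≤-trans h (subst (ℕ._≤ deg g ℕ.+ deg q ℕ.+ t)
      (ℕₚ.+-assoc (deg g) 1 t)
      (ℕₚ.+-monoˡ-≤ t (ℕₚ.+-monoʳ-≤ (deg g) q>0)))))

  -- Mass at a proper multiple `g · q` would require some `a` in `S` that `g · q` divides, and then
  -- `g` would properly divide `a`.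
  inflow-∈ : ∀ t {g} → g ∈ S → inflow (mass t) g ≡ 0ℚ
  inflow-∈ t {g} g∈S = inflow-zero (mass t) g λ q q>0 → mass-∤ t (g · q) λ {a} a∈S gq∣a →
    antichain g∈S a∈S
      (λ { refl → ℕₚ.<⇒≱ (ℕₚ.m<m+n (deg g) q>0) (∣⇒deg≤ {g · q} {g} gq∣a) })
      (∣-trans {g} {g · q} {a} (∣-·ˡ q g) gq∣a)

  -- Once the mass is replaced by the weight, the moves can be grouped by deg q, where Λ contributes
  -- `density`: 0 in degree 0 and 1 in degrees 1 to `N`.
  inflow-≤ : ∀ t g → (∀ q → 0 ℕ.< deg q → mass t (g · q) ≤ weight (g · q)) →
    inflow (mass t) g ≤ halfPow (deg g) * ∑[ k < N ] (inv (deg g ℕ.+ suc k) * inv (deg g ℕ.+ suc k))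
  inflow-≤ t g h = begin
    inflow (mass t) g
      ≤⟨ ∑ᴸ-mono U (λ q → step q (zero-or-positive (deg q))) ⟩
    ∑ᴸ U (λ q → halfPow n * (Λ q * (halfPow (deg q) * φ (deg q))))
      ≡⟨ trans (∑ᴸ-*ˡ U (halfPow n) _) (cong (halfPow n *_) (∑ᴸ-by-degree (suc N) φ)) ⟩
    halfPow n * ∑[ k < suc N ] (density k * φ k)
      ≡⟨ cong (halfPow n *_) (∑-split (λ k → density k * φ k) 1 N) ⟩
    halfPow n * (0ℚ + density 0 * φ 0 + ∑[ k < N ] (density (suc k) * φ (suc k)))
      ≤⟨ *-monoˡ (halfPow-nonneg n) (+-mono-≤
           (≤-reflexive (trans (+-identityˡ _)
             (trans (cong (_* φ 0) density-zero) (*-zeroˡ (φ 0)))))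
           (∑-mono N λ k k<N → ≤-reflexive
             (trans (cong (_* φ (suc k)) (density-suc k k<N)) (*-identityˡ _)))) ⟩
    halfPow n * (0ℚ + ∑[ k < N ] φ (suc k))
      ≡⟨ cong (halfPow n *_) (+-identityˡ _) ⟩
    halfPow n * ∑[ k < N ] φ (suc k) ∎
    where
    open ≤-Reasoning
    n = deg g
    φ : ℕ → ℚ
    φ k = inv (n ℕ.+ k) * inv (n ℕ.+ k)

    step : ∀ q → deg q ≡ 0 ⊎ 0 ℕ.< deg q →
           Λ q * (mass t (g · q) * inv (n ℕ.+ deg q)) ≤
           halfPow n * (Λ q * (halfPow (deg q) * φ (deg q)))
    step q (inj₁ q≡0) = ≤-reflexive (trans (cong (_* x) (Λ-𝟙 q≡0)) (trans (*-zeroˡ x)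
      (sym (trans (cong (λ z → halfPow n * (z * y)) (Λ-𝟙 q≡0))
        (trans (cong (halfPow n *_) (*-zeroˡ y)) (*-zeroʳ (halfPow n)))))))
      where
      x = mass t (g · q) * inv (n ℕ.+ deg q)
      y = halfPow (deg q) * φ (deg q)
    step q (inj₂ q>0) = begin
      Λ q * (mass t (g · q) * i)
        ≤⟨ *-monoˡ (Λ-nonneg q) (*-monoʳ (inv-nonneg (n ℕ.+ deg q)) (h q q>0)) ⟩
      Λ q * (halfPow (n ℕ.+ deg q) * i * i)
        ≡⟨ cong (λ z → Λ q * (z * i * i)) (halfPow-+ n (deg q)) ⟩
      Λ q * (halfPow n * halfPow (deg q) * i * i)
        ≡⟨ solve 4 (λ l a b i → l :* (a :* b :* i :* i) := a :* (l :* (b :* (i :* i)))) refl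
             (Λ q) (halfPow n) (halfPow (deg q)) i ⟩
      halfPow n * (Λ q * (halfPow (deg q) * φ (deg q))) ∎
      where i = inv (n ℕ.+ deg q)

  mass≤weight : ∀ t g → 0 ℕ.< deg g → mass t g ≤ weight g
  mass≤weight t g g>0 with g ∈? S
  mass≤weight zero    g g>0 | yes g∈S = ≤-reflexive (source-∈ g∈S)
  mass≤weight zero    g g>0 | no  g∉S = subst (_≤ weight g) (sym (source-∉ g∉S)) (weight-nonneg g)
  mass≤weight (suc t) g g>0 | yes g∈S = ≤-reflexive
    (trans (cong₂ _+_ (source-∈ g∈S) (inflow-∈ t g∈S)) (+-identityʳ _))
  mass≤weight (suc t) g@(monic (suc n) v) g>0 | no g∉S = begin
    source g + inflow (mass t) g
      ≡⟨ trans (cong (_+ inflow (mass t) g) (source-∉ g∉S)) (+-identityˡ _) ⟩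
    inflow (mass t) g
      ≤⟨ inflow-≤ t g (λ q q>0 → mass≤weight t (g · q) (s≤s z≤n)) ⟩
    halfPow (suc n) * ∑[ k < N ] (inv (suc n ℕ.+ suc k) * inv (suc n ℕ.+ suc k))
      ≤⟨ *-monoˡ (halfPow-nonneg (suc n)) (∑-inv²≤inv n N) ⟩
    weight g ∎
    where open ≤-Reasoning

  mass-𝟙≤ : mass N 𝟙 ≤ ℤ.+ 61 / 36
  -- `mass-stable` trades `mass N` for `mass (suc N)`, which unfolds to source plus inflow. The
  -- bound by `weight` would fail here, as `weight 𝟙` is 0.
  mass-𝟙≤ = subst (_≤ ℤ.+ 61 / 36) (mass-stable N 𝟙 ℕₚ.≤-refl) (begin
    source 𝟙 + inflow (mass N) 𝟙
      ≡⟨ trans (cong (_+ inflow (mass N) 𝟙)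
           (source-∉ λ 𝟙∈S → ℕₚ.<-irrefl refl (proj₁ (degree 𝟙∈S))))
           (+-identityˡ _) ⟩
    inflow (mass N) 𝟙
      ≤⟨ inflow-≤ N 𝟙 (λ q q>0 → mass≤weight N (𝟙 · q) q>0) ⟩
    1ℚ * ∑[ k < N ] (inv (suc k) * inv (suc k))
      ≡⟨ *-identityˡ _ ⟩
    ∑[ k < N ] (inv (suc k) * inv (suc k))
      ≤⟨ ∑-inv²≤61/36 N ⟩
    ℤ.+ 61 / 36 ∎)
    where open ≤-Reasoning

  ∑-source : ∑ᴸ U source ≡ ∑ᴸ S weight
  ∑-source = trans (∑ᴸ-swap U S _) (∑ᴸ-cong-∈ S λ {a} a∈S → trans
    (∑ᴸ-cong U λ g → cong (_* weight a) (indicator-cong (g ≟ a) (a ≟ g) sym sym))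
    (∑ᴸ-δ U (λ _ → weight a) (below-unique (suc N)) (∈-below⁺ (s≤s (proj₂ (degree a∈S))))))

  -- Everything except the mass at 𝟙 moves on, because Σ_{q ∣ f} Λ q = deg f.
  ∑-inflow : ∑ᴸ U (inflow (mass N)) + mass N 𝟙 ≡ ∑ᴸ U (mass N)
  ∑-inflow = begin
    ∑ᴸ U (inflow (mass N)) + mass N 𝟙
      ≡⟨ cong (_+ mass N 𝟙) moved ⟩
    ∑ᴸ U (λ f → out f * fromℕ (deg f)) + mass N 𝟙
      ≡⟨ cong (∑ᴸ U (λ f → out f * fromℕ (deg f)) +_)
           (∑ᴸ-δ U (mass N) (below-unique (suc N)) (∈-below⁺ {𝟙} {suc N} (s≤s z≤n))) ⟨
    ∑ᴸ U (λ f → out f * fromℕ (deg f)) + ∑ᴸ U (λ f → δ 𝟙 f * mass N f)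
      ≡⟨ ∑ᴸ-+ U _ _ ⟨
    ∑ᴸ U (λ f → out f * fromℕ (deg f) + δ 𝟙 f * mass N f)
      ≡⟨ ∑ᴸ-cong U leave ⟩
    ∑ᴸ U (mass N) ∎
    where
    open ≡-Reasoning
    -- Since `inv 0` is 0, nothing leaves `𝟙`: it absorbs the mass.
    out : Monic → ℚ
    out f = mass N f * inv (deg f)

    leave : ∀ f → out f * fromℕ (deg f) + δ 𝟙 f * mass N f ≡ mass N f
    leave f@(monic zero []) = trans (cong₂ _+_
      (trans (cong (_* 0ℚ) (*-zeroʳ (mass N f))) (*-zeroˡ 0ℚ))
      (trans (cong (_* mass N f) (indicator-yes (𝟙 ≟ f) refl)) (*-identityˡ (mass N f))))
      (+-identityˡ _)
    leave f@(monic (suc n) v) = trans (cong₂ _+_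
      (trans (*-assoc (mass N f) (inv (suc n)) (fromℕ (suc n)))
        (trans (cong (mass N f *_) (inv-* n)) (*-identityʳ (mass N f))))
      (trans (cong (_* mass N f) (indicator-no (𝟙 ≟ f) λ ())) (*-zeroˡ (mass N f))))
      (+-identityʳ _)

    moved : ∑ᴸ U (inflow (mass N)) ≡ ∑ᴸ U (λ f → out f * fromℕ (deg f))
    moved = begin
      ∑ᴸ U (λ g → ∑ᴸ U λ q → Λ q * out (g · q))
        -- The delta names the origin `f` of each move; origins above degree `N` carry no mass, so
        -- letting `f` range over `U` loses nothing.
        ≡⟨ ∑ᴸ-cong U (λ g → ∑ᴸ-cong U λ q → trans
             (cong (Λ q *_) (sym (∑ᴸ-below-δ (suc N) out λ N<gq → trans
               (cong (_* inv (deg g ℕ.+ deg q)) (mass-beyond N (g · q) N<gq))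
               (*-zeroˡ (inv (deg g ℕ.+ deg q))))))
             (sym (∑ᴸ-*ˡ U (Λ q) _))) ⟩
      ∑ᴸ U (λ g → ∑ᴸ U λ q → ∑ᴸ U λ f → Λ q * (δ (g · q) f * out f))
        ≡⟨ trans (∑ᴸ-cong U λ g → ∑ᴸ-swap U U _) (∑ᴸ-swap U U _) ⟩
      ∑ᴸ U (λ f → ∑ᴸ U λ g → ∑ᴸ U λ q → Λ q * (δ (g · q) f * out f))
        ≡⟨ ∑ᴸ-cong-∈ U (λ {f} f∈U → trans (∑ᴸ-swap U U _)
             (collect f (ℕₚ.≤-pred (∈-below⁻ (suc N) f∈U)))) ⟩
      ∑ᴸ U (λ f → out f * fromℕ (deg f)) ∎
      where
      collect : ∀ f → deg f ℕ.≤ N →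
        ∑ᴸ U (λ q → ∑ᴸ U λ g → Λ q * (δ (g · q) f * out f)) ≡ out f * fromℕ (deg f)
      collect f f≤N = begin
        ∑ᴸ U (λ q → ∑ᴸ U λ g → Λ q * (δ (g · q) f * out f))
          ≡⟨ ∑ᴸ-cong U (λ q → trans
               (∑ᴸ-cong U λ g → solve 3 (λ l d o → l :* (d :* o) := o :* l :* d) refl
                 (Λ q) (δ (g · q) f) (out f))
               (trans (∑ᴸ-*ˡ U (out f * Λ q) _) (trans
                 (cong (out f * Λ q *_) (indicator-∣ (below-unique (suc N)) q f λ { c refl →
                   ∈-below⁺ (s≤s (ℕₚ.≤-trans (ℕₚ.m≤m+n (deg c) (deg q)) f≤N)) }))
                 (*-assoc (out f) (Λ q) _)))) ⟩
        ∑ᴸ U (λ q → out f * (Λ q * indicator (q ∣? f)))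
          ≡⟨ ∑ᴸ-*ˡ U (out f) _ ⟩
        out f * ∑ᴸ U (λ q → Λ q * indicator (q ∣? f))
          ≡⟨ cong (out f *_) (∑Λ (suc N) f (s≤s f≤N) f≤N) ⟩
        out f * fromℕ (deg f) ∎

  -- By stability the total mass is source plus inflow; by `∑-inflow` it is also inflow plus the
  -- mass at `𝟙`. Cancelling the inflow leaves the source.
  mass-𝟙 : mass N 𝟙 ≡ ∑ᴸ S weight
  mass-𝟙 = begin
    mass N 𝟙
      ≡⟨ solve 2 (λ i m → m := i :+ m :- i) refl i (mass N 𝟙) ⟩
    i + mass N 𝟙 - i
      ≡⟨ cong (_- i) ∑-inflow ⟩
    ∑ᴸ U (mass N) - i
      ≡⟨ cong (_- i) (∑ᴸ-cong U λ g → sym (mass-stable N g (ℕₚ.m≤n+m N (deg g)))) ⟩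
    ∑ᴸ U (λ g → source g + inflow (mass N) g) - i
      ≡⟨ cong (_- i) (∑ᴸ-+ U source (inflow (mass N))) ⟩
    ∑ᴸ U source + i - i
      ≡⟨ solve 2 (λ s i → s :+ i :- i := s) refl (∑ᴸ U source) i ⟩
    ∑ᴸ U source
      ≡⟨ ∑-source ⟩
    ∑ᴸ S weight ∎
    where
    open ≡-Reasoning
    i = ∑ᴸ U (inflow (mass N))

  ∑-weight≤ : ∑ᴸ S weight ≤ ℤ.+ 61 / 36
  ∑-weight≤ = subst (_≤ ℤ.+ 61 / 36) mass-𝟙 mass-𝟙≤

-- The numerical bound

-- The right-hand side is the left Riemann sum 1/s + ⋯ + 1/(s+l-1), an upper bound for every refined
-- right sum of the same integral.
segment-coarsen : ∀ M .{{_ : ℕ.NonZero M}} s .{{_ : ℕ.NonZero s}} l →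
  segment (s ℕ.* M) (l ℕ.* M) ≤
  segment s l + recip s - recip (s ℕ.+ l) {{ℕ.>-nonZero (ℕₚ.m≤n⇒m≤n+o l (ℕ.>-nonZero⁻¹ s))}}
segment-coarsen M s l = begin
  x              ≡⟨ solve 2 (λ x y → x := x :+ y :- y) refl x y ⟩
  x + y - y      ≤⟨ +-monoˡ-≤ (- y) (segment-upper M s l) ⟩
  segment s l + recip s - y ∎
  where
  open ≤-Reasoning
  x = segment (s ℕ.* M) (l ℕ.* M)
  y = recip (s ℕ.+ l) {{ℕ.>-nonZero (ℕₚ.m≤n⇒m≤n+o l (ℕ.>-nonZero⁻¹ s))}}

-- Exactly H₂ - 29/25, with 29/25 the upper bound for log 3 below.
γ-lower : ℚ
γ-lower = ℤ.+ 17 / 50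

-- A right Riemann sum only grows under refinement; the refinement by 6 is compared with
-- the sum of mesh 1/6.
log3≤ : ∀ M .{{_ : ℕ.NonZero M}} → segment M (2 ℕ.* M) ≤ ℤ.+ 29 / 25
log3≤ M = begin
  segment M (2 ℕ.* M)
    ≤⟨ segment-lower 6 M (2 ℕ.* M) ⟩
  segment (M ℕ.* 6) (2 ℕ.* M ℕ.* 6)
    ≡⟨ cong₂ segment (ℕₚ.*-comm M 6) (trans (ℕₚ.*-assoc 2 M 6)
         (trans (cong (2 ℕ.*_) (ℕₚ.*-comm M 6)) (sym (ℕₚ.*-assoc 2 6 M)))) ⟩
  segment (6 ℕ.* M) (12 ℕ.* M)
    ≤⟨ segment-coarsen M 6 12 ⟩
  segment 6 12 + recip 6 - recip 18
    -- The value is 1/6 + ⋯ + 1/17 ≈ 1.156. Mesh 1/5 would give about 1.168, and three terms of the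
    -- exponential series would then fall short of 61/36.
    ≤⟨ toWitness {a? = segment 6 12 + recip 6 - recip 18 ≤? ℤ.+ 29 / 25} _ ⟩
  ℤ.+ 29 / 25 ∎
  where open ≤-Reasoning

-- Right Riemann sums underestimate log, so every approximation of γ is an overestimate and
-- no rate of convergence is needed.
harmonic-log≥ : ∀ k m → γ-lower ≤ approx (harmonic-log k) m
harmonic-log≥ k m = begin
  γ-lower
    ≡⟨ solve 2 (λ l c → c := l :+ c :- l) refl (log-approx k) γ-lower ⟩
  log-approx k + γ-lower - log-approx k
    ≤⟨ +-monoˡ-≤ (- log-approx k) (log+γ-lower≤harmonic k) ⟩
  harmonic (suc k) - log-approx k ∎
  where
  open ≤-Reasoning
  M = suc m

  log-approx : ℕ → ℚ
  log-approx k = segment M (k ℕ.* M)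

  split : ∀ r → log-approx (2 ℕ.+ r) ≡ log-approx 2 + segment (3 ℕ.* M) (r ℕ.* M)
  split r = trans (cong (segment M) (ℕₚ.*-distribʳ-+ M 2 r)) (segment-split M (2 ℕ.* M) (r ℕ.* M))

  log2≤log3 : log-approx 1 ≤ log-approx 2
  log2≤log3 = begin
    log-approx 1
      ≡⟨ +-identityʳ _ ⟨
    log-approx 1 + 0ℚ
      ≤⟨ +-monoʳ-≤ (log-approx 1) (∑-nonneg M λ i → 0≤/ 1 (suc (M ℕ.+ 1 ℕ.* M ℕ.+ i))) ⟩
    log-approx 1 + segment (M ℕ.+ 1 ℕ.* M) M
      ≡⟨ segment-split M (1 ℕ.* M) M ⟨
    segment M (1 ℕ.* M ℕ.+ M)
      ≡⟨ cong (segment M) (ℕₚ.+-comm (1 ℕ.* M) M) ⟩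
    log-approx 2 ∎

  log+γ-lower≤harmonic : ∀ k → log-approx k + γ-lower ≤ harmonic (suc k)
  log+γ-lower≤harmonic 0 = toWitness {a? = 0ℚ + γ-lower ≤? harmonic 1} _
  log+γ-lower≤harmonic 1 = ≤-trans (+-monoˡ-≤ γ-lower (≤-trans log2≤log3 (log3≤ M)))
    (toWitness {a? = ℤ.+ 29 / 25 + γ-lower ≤? harmonic 2} _)
  -- Beyond 3 the logarithm grows by at most 1/3 + ⋯ + 1/(2+r), which is `segment 3 r` plus 1/3 -
  -- 1/(3+r). The extra 1/3 is what turns H₃ into H₂ in the bound.
  log+γ-lower≤harmonic (suc (suc r)) = begin
    log-approx (2 ℕ.+ r) + γ-lower
      ≡⟨ cong (_+ γ-lower) (split r) ⟩
    log-approx 2 + segment (3 ℕ.* M) (r ℕ.* M) + γ-lower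
      ≤⟨ +-monoˡ-≤ γ-lower (+-mono-≤ (log3≤ M) (segment-coarsen M 3 r)) ⟩
    ℤ.+ 29 / 25 + (segment 3 r + recip 3 - recip (3 ℕ.+ r)) + γ-lower
      ≡⟨ solve 5 (λ l s t u c → l :+ (s :+ t :- u) :+ c := l :+ t :+ c :+ s :- u) refl
           (ℤ.+ 29 / 25) (segment 3 r) (recip 3) (recip (3 ℕ.+ r)) γ-lower ⟩
    ℤ.+ 29 / 25 + recip 3 + γ-lower + segment 3 r - recip (3 ℕ.+ r)
      ≤⟨ +-mono-≤
           (+-monoˡ-≤ (segment 3 r)
             (toWitness {a? = ℤ.+ 29 / 25 + recip 3 + γ-lower ≤? harmonic 3} _))
           (neg-antimono-≤ (0≤/ 1 (3 ℕ.+ r))) ⟩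
    harmonic 3 + segment 3 r + 0ℚ
      ≡⟨ +-identityʳ _ ⟩
    harmonic 3 + segment 3 r
      ≡⟨ segment-split 0 3 r ⟨
    harmonic (3 ℕ.+ r) ∎

-- Hiding the index suffices, because the bounds carried to the limit hold for all approximations of
-- every member of the sequence.
lim-approx : ∀ X (cX : Cauchyᴿ X) n → ∃[ i ] approx (lim X cX) n ≡ approx (X n) i
lim-approx X cX n = _ , refl

γ≥ : ∀ n → γ-lower ≤ approx γ n
γ≥ n = let i , e = lim-approx harmonic-log harmonic-log-cauchy n in
  subst (γ-lower ≤_) (sym e) (harmonic-log≥ n i)

pf-mono : ∀ {p q} → 0ℚ ≤ p → p ≤ q → ∀ j → 0ℚ ≤ pf p j × pf p j ≤ pf q j
pf-mono 0≤p p≤q zero = 0≤/ 1 1 , ≤-refl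
pf-mono 0≤p p≤q (suc j) = let 0≤pf , pf≤ = pf-mono 0≤p p≤q j in
  *-nonneg (*-nonneg 0≤pf 0≤p) (0≤/ 1 (suc j)) ,
  *-monoʳ (0≤/ 1 (suc j)) (*-mono 0≤p (≤-trans 0≤pf pf≤) pf≤ p≤q)

-- This approximation of `exp x` is a partial sum with `k ℕ.+ d` terms at some approximation of `x`:
-- the first `k` terms are monotone in the argument and the rest are nonnegative.
exp≥ : ∀ {p} x → 0ℚ ≤ p → (∀ i → p ≤ approx x i) → ∀ k d →
       ∑ k (pf p) ≤ approx (exp x) (k ℕ.+ d)
exp≥ {p} x 0≤p p≤x k d = begin
  ∑ k (pf p)
    ≤⟨ ∑-mono k (λ j _ → proj₂ (pf-mono 0≤p (p≤x i) j)) ⟩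
  ∑ k (pf q)                                    ≡⟨ +-identityʳ _ ⟨
  ∑ k (pf q) + 0ℚ
    ≤⟨ +-monoʳ-≤ (∑ k (pf q)) (∑-nonneg d λ j →
         proj₁ (pf-mono (≤-trans 0≤p (p≤x i)) (≤-refl {q}) (k ℕ.+ j))) ⟩
  ∑ k (pf q) + ∑[ j < d ] pf q (k ℕ.+ j)        ≡⟨ ∑-split (pf q) k d ⟨
  ∑ (k ℕ.+ d) (pf q)                            ≡⟨ expPartial-approx x (k ℕ.+ d) i ⟨
  approx (expPartial x (k ℕ.+ d)) i             ≡⟨ e ⟨
  approx (exp x) (k ℕ.+ d)                      ∎
  where
  open ≤-Reasoning
  lim-index = lim-approx (expPartial x) (expPartial-cauchy x) (k ℕ.+ d)
  i = proj₁ lim-index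
  e = proj₂ lim-index
  q = approx x i

-- x is kept abstract: with exp γ in its place Agda unfolds the limits.
61/36<1+½* : ∀ x → (∀ d → ∑ 3 (pf γ-lower) ≤ approx x (3 ℕ.+ d)) →
             fromℚ (ℤ.+ 61 / 36) <ᴿ (fromℚ 1ℚ +ᴿ fromℚ ½ *ᴿ x)
-- The gap 1.6989 - 61/36 ≈ 0.00446 leaves room for 1/250; from index 3 on, the terms 1 + γ + γ²/2
-- are present.
61/36<1+½* x h = recip 250 , 0<recip 249 , 3 , λ {n} 3≤n →
  subst (λ n → ℤ.+ 61 / 36 + recip 250 ≤ 1ℚ + ½ * approx x n) (ℕₚ.m+[n∸m]≡n 3≤n)
    (≤-trans (toWitness {a? = ℤ.+ 61 / 36 + recip 250 ≤? 1ℚ + ½ * ∑ 3 (pf γ-lower)} _)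
      (+-monoʳ-≤ 1ℚ (*-monoˡ (0≤/ 1 2) (h (n ℕ.∸ 3)))))

61/36<1+½*exp-γ : fromℚ (ℤ.+ 61 / 36) <ᴿ (fromℚ 1ℚ +ᴿ fromℚ ½ *ᴿ exp γ)
61/36<1+½*exp-γ = 61/36<1+½* (exp γ) (exp≥ γ (0≤/ 17 50) γ≥ 3)

theorem4p6 : ∀ {ℓ} (A : Pred Monic ℓ) → Primitive A → ¬ (A ≐ ｛ 𝟙 ｝) →
    𝓕 A < (fromℚ 1ℚ +ᴿ fromℚ ½ *ᴿ exp γ)
theorem4p6 A primitive-A A≢𝟙 = record
  { positiveDegree = λ {a} → degree>0 a
  ; bound          = ℤ.+ 61 / 36
  ; bound<c        = 61/36<1+½*exp-γ
  ; partialSums    = λ {as} unique as⊆A nzs →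
      -- The cutoff varies with the finite subset, the bound 61/36 does not.
      let N = max 0 (map deg as)
          degree : ∀ {a} → a ∈ as → 0 ℕ.< deg a × deg a ℕ.≤ N
          degree {a} a∈as = ℕ.>-nonZero⁻¹ (deg a) {{All.lookup nzs a∈as}} ,
            All.lookup (xs≤max 0 (map deg as)) (∈-map⁺ deg a∈as)
          antichain : ∀ {a b} → a ∈ as → b ∈ as → a ≢ b → ¬ a ∣ b
          antichain a∈as b∈as = primitive-A (All.lookup as⊆A a∈as) (All.lookup as⊆A b∈as)
      in ≤-trans (≤-reflexive (finiteSum≡∑ nzs))
           (Flow.∑-weight≤ N as unique degree (λ {a} {b} → antichain {a} {b}))
  }
  where
  𝟙∉A : ¬ A 𝟙
  -- `𝟙` divides everything, so a primitive set that contains it has no other element.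
  𝟙∉A 𝟙∈A = A≢𝟙 ((λ {b} → only b) , λ { refl → 𝟙∈A })
    where
    only : ∀ b → A b → 𝟙 ≡ b
    only b b∈A with 𝟙 ≟ b
    ... | yes 𝟙≡b = 𝟙≡b
    ... | no  𝟙≢b = contradiction (𝟙∣ b) (primitive-A 𝟙∈A b∈A 𝟙≢b)

  degree>0 : ∀ a → A a → PositiveDegree a
  degree>0 (monic zero [])    𝟙∈A = contradiction 𝟙∈A 𝟙∉A
  degree>0 (monic (suc n) v) _   = _
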